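{- Let $f\in\mathbb{Z}[X]$ be a monic irreducible polynomial of degree $n\ge 2$, let $\theta$ be a root of $f$, and let $K=\mathbb{Q}(\theta)$ with ring of integers $\mathcal{O}_K$. Let $p$ be a prime number and $r\in\mathbb{Z}$. Suppose that $p^2\mid f(r)$ and $p\mid f'(r)$. Then $p\mid I(\theta)$; in particular $\mathbb{Z}[\theta]\neq\mathcal{O}_K$.
   Context: $I(\theta)=[\mathcal{O}_K:\mathbb{Z}[\theta]]$ denotes the index of the order $\mathbb{Z}[\theta]$ in $\mathcal{O}_K$. -}

module Defs where

open import Algebra.Apartness.Bundles using (HeytingField; HeytingCommutativeRing)
open import Algebra.Bundles using (CommutativeMonoid; CommutativeRing)
open import Algebra.Bundles.Raw using (RawRing; RawSemiring)
open import Algebra.Morphism.Structures using (IsRingHomomorphism)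
import Algebra.Definitions.RawSemiring as SemiringDefinitions
import Algebra.Properties.AbelianGroup as AbelianGroupProperties
import Algebra.Properties.CommutativeSemigroup as CommutativeSemigroupProperties
import Algebra.Properties.Ring as RingProperties
open import Data.Fin.Base using (Fin)
open import Data.Integer.Base as ℤ using (ℤ; +_; 0ℤ; 1ℤ)
import Data.Integer.Properties as ℤ
open import Data.List.Base using (List; []; _∷_; map)
open import Data.Nat.Base as ℕ using (ℕ; zero; suc)
open import Data.Product.Base using (Σ; ∃; _×_; _,_; proj₁)
open import Data.Rational.Base as ℚ using (ℚ; _/_)
import Data.Rational.Properties as ℚ
open import Data.Rational.Unnormalised.Base as ℚᵘ using (mkℚᵘ; *≡*)
import Data.Rational.Unnormalised.Properties as ℚᵘ
open import Function.Bundles using (Bijection)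
open import Level using (Level; 0ℓ; _⊔_) renaming (suc to lsuc)
open import Relation.Binary.Bundles using (Setoid)
open import Relation.Binary.PropositionalEquality as ≡ using (_≡_)
import Relation.Binary.Reasoning.Setoid as SetoidReasoning
open import Relation.Unary using (Pred)

-- Coefficients are listed from the constant term upwards. Trailing zeros are
-- allowed, so polynomials are compared with _≈ₚ_ and not with _≡_.
ℤ[X] : Set
ℤ[X] = List ℤ

coeff : ℤ[X] → ℕ → ℤ
coeff []      _       = 0ℤ
coeff (a ∷ _) zero    = a
coeff (_ ∷ g) (suc i) = coeff g i

infix 4 _≈ₚ_
_≈ₚ_ : ℤ[X] → ℤ[X] → Set
g ≈ₚ h = ∀ i → coeff g i ≡ coeff h i

infixl 6 _+ₚ_
_+ₚ_ : ℤ[X] → ℤ[X] → ℤ[X]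
[]      +ₚ h       = h
(a ∷ g) +ₚ []      = a ∷ g
(a ∷ g) +ₚ (b ∷ h) = (a ℤ.+ b) ∷ (g +ₚ h)

-ₚ_ : ℤ[X] → ℤ[X]
-ₚ_ = map (λ a → ℤ.- a)

-- (a + X g) h = a h + X (g h)
infixl 7 _*ₚ_
_*ₚ_ : ℤ[X] → ℤ[X] → ℤ[X]
[]      *ₚ h = []
(a ∷ g) *ₚ h = map (a ℤ.*_) h +ₚ (0ℤ ∷ (g *ₚ h))

ℤ[X]-rawSemiring : RawSemiring 0ℓ 0ℓ
ℤ[X]-rawSemiring = record
  { Carrier = ℤ[X]
  ; _≈_     = _≈ₚ_
  ; _+_     = _+ₚ_
  ; _*_     = _*ₚ_
  ; 0#      = []
  ; 1#      = 1ℤ ∷ []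
  }

open SemiringDefinitions ℤ[X]-rawSemiring public using (Irreducible)

MonicOfDegree : ℕ → ℤ[X] → Set
MonicOfDegree n g = coeff g n ≡ 1ℤ × (∀ i → n ℕ.< i → coeff g i ≡ 0ℤ)

Monic : ℤ[X] → Set
Monic g = ∃ λ n → MonicOfDegree n g

-- weighted k [a₀, a₁, …] = [k a₀, (k + 1) a₁, …]
weighted : ℕ → ℤ[X] → ℤ[X]
weighted k []      = []
weighted k (a ∷ g) = (+ k ℤ.* a) ∷ weighted (suc k) g

derivative : ℤ[X] → ℤ[X]
derivative []      = []
derivative (_ ∷ g) = weighted 1 g

horner : ∀ {c ℓ} (R : RawRing c ℓ) → let open RawRing R in
         List Carrier → Carrier → Carrier
horner R []      x = 0#
  where open RawRing R
horner R (a ∷ g) x = a + x * horner R g x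
  where open RawRing R

evalℤ : ℤ[X] → ℤ → ℤ
evalℤ = horner ℤ.+-*-rawRing

/1-homo-+ : ∀ a b → (a ℤ.+ b) / 1 ≡ a / 1 ℚ.+ b / 1
/1-homo-+ a b = ℚ.toℚᵘ-injective (begin
  ℚ.toℚᵘ ((a ℤ.+ b) / 1)
    ≈⟨ ℚ.toℚᵘ-fromℚᵘ (mkℚᵘ (a ℤ.+ b) 0) ⟩
  mkℚᵘ (a ℤ.+ b) 0
    ≈⟨ *≡* (≡.cong (ℤ._* 1ℤ)
         (≡.cong₂ ℤ._+_ (ℤ.*-identityʳ a) (ℤ.*-identityʳ b))) ⟨
  mkℚᵘ a 0 ℚᵘ.+ mkℚᵘ b 0
    ≈⟨ ℚᵘ.+-cong (ℚ.toℚᵘ-fromℚᵘ (mkℚᵘ a 0)) (ℚ.toℚᵘ-fromℚᵘ (mkℚᵘ b 0)) ⟨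
  ℚ.toℚᵘ (a / 1) ℚᵘ.+ ℚ.toℚᵘ (b / 1)
    ≈⟨ ℚ.toℚᵘ-homo-+ (a / 1) (b / 1) ⟨
  ℚ.toℚᵘ (a / 1 ℚ.+ b / 1)
    ∎)
  where open SetoidReasoning ℚᵘ.≃-setoid

/1-homo-neg : ∀ a → (ℤ.- a) / 1 ≡ ℚ.- (a / 1)
/1-homo-neg a = ℚ.toℚᵘ-injective (begin
  ℚ.toℚᵘ ((ℤ.- a) / 1)     ≈⟨ ℚ.toℚᵘ-fromℚᵘ (mkℚᵘ (ℤ.- a) 0) ⟩
  ℚᵘ.- mkℚᵘ a 0            ≈⟨ ℚᵘ.-‿cong (ℚ.toℚᵘ-fromℚᵘ (mkℚᵘ a 0)) ⟨
  ℚᵘ.- ℚ.toℚᵘ (a / 1)      ≈⟨ ℚ.toℚᵘ-homo‿- (a / 1) ⟨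
  ℚ.toℚᵘ (ℚ.- (a / 1))     ∎)
  where open SetoidReasoning ℚᵘ.≃-setoid

-- For a field given classically, _#_ is the negation of _≈_.
record ExtensionOfℚ c ℓ₁ ℓ₂ : Set (lsuc (c ⊔ ℓ₁ ⊔ ℓ₂)) where
  field
    heytingField : HeytingField c ℓ₁ ℓ₂

  open HeytingField heytingField public
    using (Carrier; _≈_; _#_; _+_; _*_; -_; _-_; 0#; 1#)

  commutativeRing : CommutativeRing c ℓ₁
  commutativeRing = HeytingCommutativeRing.commutativeRing
    (HeytingField.heytingCommutativeRing heytingField)

  open CommutativeRing commutativeRing public using (rawRing)

  field
    ι      : ℚ → Carrier
    ι-homo : IsRingHomomorphism ℚ.+-*-rawRing rawRing ι

  fromℤ : ℤ → Carrier
  fromℤ a = ι (a / 1)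

  eval : ℤ[X] → Carrier → Carrier
  eval g = horner rawRing (map fromℤ g)

module Extension {c ℓ₁ ℓ₂} (K : ExtensionOfℚ c ℓ₁ ℓ₂) where
  open ExtensionOfℚ K public

  -- The subfield of K generated by θ.
  data ℚ⟨_⟩ (θ : Carrier) : Pred Carrier (c ⊔ ℓ₁) where
    resp      : ∀ {x y} → x ≈ y → ℚ⟨ θ ⟩ x → ℚ⟨ θ ⟩ y
    rational  : ∀ q → ℚ⟨ θ ⟩ (ι q)
    generator : ℚ⟨ θ ⟩ θ
    add       : ∀ {x y} → ℚ⟨ θ ⟩ x → ℚ⟨ θ ⟩ y → ℚ⟨ θ ⟩ (x + y)
    neg       : ∀ {x} → ℚ⟨ θ ⟩ x → ℚ⟨ θ ⟩ (- x)
    mul       : ∀ {x y} → ℚ⟨ θ ⟩ x → ℚ⟨ θ ⟩ y → ℚ⟨ θ ⟩ (x * y)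
    inverse   : ∀ {x y} → ℚ⟨ θ ⟩ x → x * y ≈ 1# → ℚ⟨ θ ⟩ y

  GeneratedBy : Carrier → Set (c ⊔ ℓ₁)
  GeneratedBy θ = ∀ x → ℚ⟨ θ ⟩ x

  𝒪 : Pred Carrier ℓ₁
  𝒪 x = ∃ λ g → Monic g × eval g x ≈ 0#

  ℤ[_] : Carrier → Pred Carrier ℓ₁
  ℤ[ θ ] x = ∃ λ g → eval g θ ≈ x

  private
    module R = CommutativeRing commutativeRing
    module ι = IsRingHomomorphism ι-homo
  open SetoidReasoning R.setoid
  open AbelianGroupProperties R.+-abelianGroup
    using (⁻¹-∙-comm; ε⁻¹≈ε; ⁻¹-anti-homo‿-)
  open CommutativeSemigroupProperties
    (CommutativeMonoid.commutativeSemigroup R.+-commutativeMonoid)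
    using (interchange)
  open RingProperties R.ring using (-‿distribʳ-*)

  fromℤ-+ : ∀ a b → fromℤ (a ℤ.+ b) ≈ fromℤ a + fromℤ b
  fromℤ-+ a b = R.trans (ι.⟦⟧-cong (/1-homo-+ a b)) (ι.+-homo (a / 1) (b / 1))

  fromℤ-neg : ∀ a → fromℤ (ℤ.- a) ≈ - fromℤ a
  fromℤ-neg a = R.trans (ι.⟦⟧-cong (/1-homo-neg a)) (ι.-‿homo (a / 1))

  eval-+ : ∀ g h x → eval (g +ₚ h) x ≈ eval g x + eval h x
  eval-+ []      h       x = R.sym (R.+-identityˡ _)
  eval-+ (a ∷ g) []      x = R.sym (R.+-identityʳ _)
  eval-+ (a ∷ g) (b ∷ h) x = begin
    fromℤ (a ℤ.+ b) + x * eval (g +ₚ h) x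
      ≈⟨ R.+-cong (fromℤ-+ a b) (R.*-congˡ (eval-+ g h x)) ⟩
    (fromℤ a + fromℤ b) + x * (eval g x + eval h x)
      ≈⟨ R.+-congˡ (R.distribˡ x _ _) ⟩
    (fromℤ a + fromℤ b) + (x * eval g x + x * eval h x)
      ≈⟨ interchange _ _ _ _ ⟩
    (fromℤ a + x * eval g x) + (fromℤ b + x * eval h x)
      ∎

  eval-neg : ∀ g x → eval (-ₚ g) x ≈ - eval g x
  eval-neg []      x = R.sym ε⁻¹≈ε
  eval-neg (a ∷ g) x = begin
    fromℤ (ℤ.- a) + x * eval (-ₚ g) x
      ≈⟨ R.+-cong (fromℤ-neg a) (R.*-congˡ (eval-neg g x)) ⟩
    - fromℤ a + x * - eval g x
      ≈⟨ R.+-congˡ (-‿distribʳ-* x _) ⟨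
    - fromℤ a + - (x * eval g x)
      ≈⟨ ⁻¹-∙-comm _ _ ⟩
    - (fromℤ a + x * eval g x)
      ∎

  telescope : ∀ x y z → (x - y) + (y - z) ≈ x - z
  telescope x y z = begin
    (x - y) + (y - z)      ≈⟨ R.+-assoc x (- y) (y - z) ⟩
    x + (- y + (y - z))    ≈⟨ R.+-congˡ (R.+-assoc (- y) y (- z)) ⟨
    x + ((- y + y) - z)    ≈⟨ R.+-congˡ (R.+-congʳ (R.-‿inverseˡ y)) ⟩
    x + (0# - z)           ≈⟨ R.+-congˡ (R.+-identityˡ (- z)) ⟩
    x - z                  ∎

  -- The additive quotient 𝒪 / ℤ[θ].
  𝒪/ℤ[_] : Carrier → Setoid (c ⊔ ℓ₁) ℓ₁
  𝒪/ℤ[ θ ] = record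
    { Carrier       = Σ Carrier 𝒪
    ; _≈_           = λ x y → ℤ[ θ ] (proj₁ x - proj₁ y)
    ; isEquivalence = record
      { refl  = λ {x} → [] , R.sym (R.-‿inverseʳ (proj₁ x))
      ; sym   = λ {x} {y} (g , g≈) → -ₚ g ,
          R.trans (eval-neg g θ)
            (R.trans (R.-‿cong g≈) (⁻¹-anti-homo‿- (proj₁ x) (proj₁ y)))
      ; trans = λ {x} {y} {z} (g , g≈) (h , h≈) → g +ₚ h ,
          R.trans (eval-+ g h θ)
            (R.trans (R.+-cong g≈ h≈) (telescope (proj₁ x) (proj₁ y) (proj₁ z)))
      }
    }

  -- [ 𝒪 : ℤ[θ] ] = m, as a relation.
  HasIndex : Carrier → ℕ → Set (c ⊔ ℓ₁)
  HasIndex θ m = Bijection 𝒪/ℤ[ θ ] (≡.setoid (Fin m))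

{-# OPTIONS --safe #-}
module Submission where

open import Defs
open import Algebra.Apartness.Bundles using (HeytingField)
open import Algebra.Bundles using (CommutativeRing)
import Algebra.Definitions.RawMagma as Divisibility
open import Algebra.Morphism.Structures using (IsRingHomomorphism)
import Algebra.Properties.AbelianGroup as AbelianGroupProperties
import Algebra.Properties.CommutativeMonoid.Sum as Sum
import Algebra.Properties.Monoid.Mult as Mult
import Algebra.Properties.Ring as RingProperties
import Algebra.Properties.Semiring.Exp as Exp
import Algebra.Solver.Ring as RingSolver
open import Algebra.Solver.Ring.AlmostCommutativeRing
  using (AlmostCommutativeRing; fromCommutativeRing; _-Raw-AlmostCommutative⟶_; Induced-equivalence)
open import Data.Fin.Base as Fin using (Fin)
open import Data.Fin.Permutation using (Permutation; permutation)
open import Data.Integer.Base as ℤ using (ℤ; +_; -[1+_]; 0ℤ; 1ℤ; _^_)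
open import Data.Integer.Divisibility using () renaming (_∣_ to _∣ℤ_)
import Data.Integer.Divisibility.Signed as Signed
import Data.Integer.Properties as ℤ
open import Data.Integer.Solver using (module +-*-Solver)
open import Data.List.Base using ([]; _∷_; map)
open import Data.List.Relation.Unary.All using (All; []; _∷_)
open import Data.Maybe.Base using (just; nothing)
open import Data.Nat.Base as ℕ using (ℕ; zero; suc; _≤_; _<_; z≤n; s≤s)
open import Data.Nat.Coprimality using (Coprime; coprime-Bézout)
open import Data.Nat.Divisibility using (_∣_; _∣?_; ∣1⇒≡1)
open import Data.Nat.GCD using (module Bézout)
open import Data.Nat.ListAction using (product)
open import Data.Nat.Primality as Primality using (Prime)
open import Data.Nat.Primality.Factorisation using (factorise; module PrimeFactorisation)
import Data.Nat.Properties as ℕ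
open import Data.Product.Base using (_×_; ∃; ∃₂; _,_; proj₁; proj₂)
open import Data.Rational.Base as ℚ using (_/_)
import Data.Rational.Properties as ℚ
open import Data.Rational.Unnormalised.Base as ℚᵘ using (mkℚᵘ; *≡*)
import Data.Rational.Unnormalised.Properties as ℚᵘ
open import Data.Sum.Base using (_⊎_; inj₁; inj₂; [_,_]′)
open import Function.Bundles using (module Bijection)
open import Level using (_⊔_)
open import Relation.Binary.Definitions using (WeaklyDecidable)
open import Relation.Binary.PropositionalEquality as ≡ using (_≡_; _≢_; cong; cong₂; module ≡-Reasoning)
import Relation.Binary.Reasoning.Setoid as SetoidReasoning
open import Relation.Nullary.Decidable using (yes; no; decidable-stable)
open import Relation.Nullary.Negation using (¬_; contradiction)
open import Relation.Unary using (Pred; _⊆_; _≐_)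

-- Write f = f(r) + (X − r) g and g = f′(r) + (X − r) h, and let α = g(θ)/p.
-- With f(r) = d p² and f′(r) = b p one gets α² = b α − d h(θ), so α is integral
-- over ℤ[θ], hence over ℤ. By Gauss's lemma f divides every integer polynomial
-- vanishing at θ, whereas a relation α = u(θ) would give the nonzero polynomial
-- p u − g of degree below n, so α ∉ ℤ[θ]. Finally p α ∈ ℤ[θ], and m α ∈ ℤ[θ]
-- when m is the index, so p and m are not coprime.

-- Polynomials over ℤ

-- The hypotheses are tailored to a quadratic equation: since (θ - r) g(θ) = -d p², one gets g(θ)² =
-- b p g(θ) - d p² h(θ), whose linear and constant coefficients are divisible by p and by p². That
-- is exactly what division of the root by p requires. Two obstacles shape the rest. Moreover
-- `HasIndex` only counts classes: it is a bijection of setoids, with no group law on `Fin m`. To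
-- exploit it, translation by α has to permute the classes, so 𝒪 must be stable under adding α and
-- -α; this rests on the same transitivity of integrality that puts α in 𝒪.

DegreeBelow : ℕ → ℤ[X] → Set
DegreeBelow k g = ∀ i → k ≤ i → coeff g i ≡ 0ℤ

infixl 7 _·ₚ_
_·ₚ_ : ℤ → ℤ[X] → ℤ[X]
c ·ₚ g = map (c ℤ.*_) g

coeff-+ : ∀ g h i → coeff (g +ₚ h) i ≡ coeff g i ℤ.+ coeff h i
coeff-+ []      h       i       = ≡.sym (ℤ.+-identityˡ _)
coeff-+ (a ∷ g) []      i       = ≡.sym (ℤ.+-identityʳ _)
coeff-+ (a ∷ g) (b ∷ h) zero    = ≡.refl
coeff-+ (a ∷ g) (b ∷ h) (suc i) = coeff-+ g h i

coeff-· : ∀ c g i → coeff (c ·ₚ g) i ≡ c ℤ.* coeff g i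
coeff-· c []      i       = ≡.sym (ℤ.*-zeroʳ c)
coeff-· c (a ∷ g) zero    = ≡.refl
coeff-· c (a ∷ g) (suc i) = coeff-· c g i

coeff-neg : ∀ g i → coeff (-ₚ g) i ≡ ℤ.- coeff g i
coeff-neg []      i       = ≡.refl
coeff-neg (a ∷ g) zero    = ≡.refl
coeff-neg (a ∷ g) (suc i) = coeff-neg g i

coeff-∷-* : ∀ a g h i →
  coeff ((a ∷ g) *ₚ h) i ≡ a ℤ.* coeff h i ℤ.+ coeff (0ℤ ∷ g *ₚ h) i
coeff-∷-* a g h i =
  ≡.trans (coeff-+ (a ·ₚ h) (0ℤ ∷ g *ₚ h) i)
          (cong (ℤ._+ coeff (0ℤ ∷ g *ₚ h) i) (coeff-· a h i))

monomial : ℤ → ℕ → ℤ[X]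
monomial a zero    = a ∷ []
monomial a (suc d) = 0ℤ ∷ monomial a d

coeff-monomial : ∀ a d → coeff (monomial a d) d ≡ a
coeff-monomial a zero    = ≡.refl
coeff-monomial a (suc d) = coeff-monomial a d

monomial< : ∀ a d → DegreeBelow (suc d) (monomial a d)
monomial< a zero    (suc i) _        = ≡.refl
monomial< a (suc d) (suc i) (s≤s le) = monomial< a d i le

*ₚ-zeroˡ : ∀ g h → DegreeBelow 0 g → DegreeBelow 0 (g *ₚ h)
*ₚ-zeroˡ []      h g≈0 i _ = ≡.refl
*ₚ-zeroˡ (a ∷ g) h g≈0 i _ = begin
  coeff ((a ∷ g) *ₚ h) i                        ≡⟨ coeff-∷-* a g h i ⟩
  a ℤ.* coeff h i ℤ.+ coeff (0ℤ ∷ g *ₚ h) i     ≡⟨ cong₂ ℤ._+_ (cong (ℤ._* coeff h i) (g≈0 0 z≤n)) (shifted i) ⟩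
  0ℤ ℤ.* coeff h i ℤ.+ 0ℤ                       ≡⟨⟩
  0ℤ                                            ∎
  where
  open ≡-Reasoning
  shifted : ∀ i → coeff (0ℤ ∷ g *ₚ h) i ≡ 0ℤ
  shifted zero    = ≡.refl
  shifted (suc i) = *ₚ-zeroˡ g h (λ j _ → g≈0 (suc j) z≤n) i z≤n

·ₚ-*ₚ-assoc : ∀ c g h → (c ·ₚ g) *ₚ h ≈ₚ c ·ₚ (g *ₚ h)
·ₚ-*ₚ-assoc c []      h i = ≡.refl
·ₚ-*ₚ-assoc c (a ∷ g) h i = begin
  coeff ((c ·ₚ (a ∷ g)) *ₚ h) i
    ≡⟨ coeff-∷-* (c ℤ.* a) (c ·ₚ g) h i ⟩
  c ℤ.* a ℤ.* coeff h i ℤ.+ coeff (0ℤ ∷ (c ·ₚ g) *ₚ h) i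
    ≡⟨ cong₂ ℤ._+_ (ℤ.*-assoc c a _) (shifted i) ⟩
  c ℤ.* (a ℤ.* coeff h i) ℤ.+ c ℤ.* coeff (0ℤ ∷ g *ₚ h) i
    ≡⟨ ℤ.*-distribˡ-+ c _ _ ⟨
  c ℤ.* (a ℤ.* coeff h i ℤ.+ coeff (0ℤ ∷ g *ₚ h) i)
    ≡⟨ cong (c ℤ.*_) (coeff-∷-* a g h i) ⟨
  c ℤ.* coeff ((a ∷ g) *ₚ h) i
    ≡⟨ coeff-· c ((a ∷ g) *ₚ h) i ⟨
  coeff (c ·ₚ ((a ∷ g) *ₚ h)) i
    ∎
  where
  open ≡-Reasoning
  shifted : ∀ i → coeff (0ℤ ∷ (c ·ₚ g) *ₚ h) i ≡ c ℤ.* coeff (0ℤ ∷ g *ₚ h) i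
  shifted zero    = ≡.sym (ℤ.*-zeroʳ c)
  shifted (suc i) = ≡.trans (·ₚ-*ₚ-assoc c g h i) (coeff-· c (g *ₚ h) i)

coeff-pos-*-· : ∀ m n g i → coeff (+ (m ℕ.* n) ·ₚ g) i ≡ + m ℤ.* (+ n ℤ.* coeff g i)
coeff-pos-*-· m n g i = begin
  coeff (+ (m ℕ.* n) ·ₚ g) i           ≡⟨ coeff-· (+ (m ℕ.* n)) g i ⟩
  + (m ℕ.* n) ℤ.* coeff g i            ≡⟨ cong (ℤ._* coeff g i) (ℤ.pos-* m n) ⟩
  + m ℤ.* + n ℤ.* coeff g i            ≡⟨ ℤ.*-assoc (+ m) (+ n) _ ⟩
  + m ℤ.* (+ n ℤ.* coeff g i)          ∎
  where open ≡-Reasoning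

-- The product is defined by recursion on the left factor; this mirror rule lets `gauss` remove the
-- constant term of the right one.
*ₚ-∷ : ∀ g b h → g *ₚ (b ∷ h) ≈ₚ (b ·ₚ g) +ₚ (0ℤ ∷ g *ₚ h)
*ₚ-∷ []      b h zero    = ≡.refl
*ₚ-∷ []      b h (suc i) = ≡.refl
*ₚ-∷ (a ∷ g) b h zero    = cong (ℤ._+ 0ℤ) (ℤ.*-comm a b)
*ₚ-∷ (a ∷ g) b h (suc i) = begin
  coeff ((a ·ₚ h) +ₚ g *ₚ (b ∷ h)) i
    ≡⟨ coeff-+ (a ·ₚ h) (g *ₚ (b ∷ h)) i ⟩
  coeff (a ·ₚ h) i ℤ.+ coeff (g *ₚ (b ∷ h)) i
    ≡⟨ cong (λ z → coeff (a ·ₚ h) i ℤ.+ z) (≡.trans (*ₚ-∷ g b h i) (coeff-+ (b ·ₚ g) (0ℤ ∷ g *ₚ h) i)) ⟩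
  coeff (a ·ₚ h) i ℤ.+ (coeff (b ·ₚ g) i ℤ.+ coeff (0ℤ ∷ g *ₚ h) i)
    ≡⟨ solve 3 (λ x y z → x :+ (y :+ z) := y :+ (x :+ z)) ≡.refl (coeff (a ·ₚ h) i) (coeff (b ·ₚ g) i) _ ⟩
  coeff (b ·ₚ g) i ℤ.+ (coeff (a ·ₚ h) i ℤ.+ coeff (0ℤ ∷ g *ₚ h) i)
    ≡⟨ cong (λ z → coeff (b ·ₚ g) i ℤ.+ z) (coeff-+ (a ·ₚ h) (0ℤ ∷ g *ₚ h) i) ⟨
  coeff (b ·ₚ g) i ℤ.+ coeff ((a ∷ g) *ₚ h) i
    ≡⟨ coeff-+ (b ·ₚ g) ((a ∷ g) *ₚ h) i ⟨
  coeff ((b ·ₚ g) +ₚ ((a ∷ g) *ₚ h)) i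
    ∎
  where
  open ≡-Reasoning
  open +-*-Solver

*ₚ-·ₚ-comm : ∀ g c h → g *ₚ (c ·ₚ h) ≈ₚ c ·ₚ (g *ₚ h)
*ₚ-·ₚ-comm []      c h i = ≡.refl
*ₚ-·ₚ-comm (a ∷ g) c h i = begin
  coeff ((a ∷ g) *ₚ (c ·ₚ h)) i
    ≡⟨ coeff-∷-* a g (c ·ₚ h) i ⟩
  a ℤ.* coeff (c ·ₚ h) i ℤ.+ coeff (0ℤ ∷ g *ₚ (c ·ₚ h)) i
    ≡⟨ cong₂ ℤ._+_ (cong (a ℤ.*_) (coeff-· c h i)) (shifted i) ⟩
  a ℤ.* (c ℤ.* coeff h i) ℤ.+ c ℤ.* coeff (0ℤ ∷ g *ₚ h) i
    ≡⟨ solve 4 (λ a c x y → a :* (c :* x) :+ c :* y := c :* (a :* x :+ y)) ≡.refl a c (coeff h i) _ ⟩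
  c ℤ.* (a ℤ.* coeff h i ℤ.+ coeff (0ℤ ∷ g *ₚ h) i)
    ≡⟨ cong (c ℤ.*_) (coeff-∷-* a g h i) ⟨
  c ℤ.* coeff ((a ∷ g) *ₚ h) i
    ≡⟨ coeff-· c ((a ∷ g) *ₚ h) i ⟨
  coeff (c ·ₚ ((a ∷ g) *ₚ h)) i
    ∎
  where
  open ≡-Reasoning
  open +-*-Solver
  shifted : ∀ i → coeff (0ℤ ∷ g *ₚ (c ·ₚ h)) i ≡ c ℤ.* coeff (0ℤ ∷ g *ₚ h) i
  shifted zero    = ≡.sym (ℤ.*-zeroʳ c)
  shifted (suc i) = ≡.trans (*ₚ-·ₚ-comm g c h i) (coeff-· c (g *ₚ h) i)

-- In the convolution every other term has an index beyond one of the two bounds. The coefficients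
-- at i and j are allowed to vanish.
leading-* : ∀ g h i j → DegreeBelow (suc i) g → DegreeBelow (suc j) h →
  coeff (g *ₚ h) (i ℕ.+ j) ≡ coeff g i ℤ.* coeff h j
leading-* []      h i       j g< h< = ≡.refl
leading-* (a ∷ g) h zero    j g< h< = begin
  coeff ((a ∷ g) *ₚ h) j                       ≡⟨ coeff-∷-* a g h j ⟩
  a ℤ.* coeff h j ℤ.+ coeff (0ℤ ∷ g *ₚ h) j    ≡⟨ cong (λ z → a ℤ.* coeff h j ℤ.+ z) (shifted j) ⟩
  a ℤ.* coeff h j ℤ.+ 0ℤ                       ≡⟨ ℤ.+-identityʳ _ ⟩
  a ℤ.* coeff h j                              ∎
  where
  open ≡-Reasoning
  shifted : ∀ j → coeff (0ℤ ∷ g *ₚ h) j ≡ 0ℤ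
  shifted zero    = ≡.refl
  shifted (suc j) = *ₚ-zeroˡ g h (λ i _ → g< (suc i) (s≤s z≤n)) j z≤n
leading-* (a ∷ g) h (suc i) j g< h< = begin
  coeff ((a ∷ g) *ₚ h) (suc i ℕ.+ j)
    ≡⟨ coeff-∷-* a g h (suc i ℕ.+ j) ⟩
  a ℤ.* coeff h (suc i ℕ.+ j) ℤ.+ coeff (g *ₚ h) (i ℕ.+ j)
    ≡⟨ cong (λ z → a ℤ.* z ℤ.+ coeff (g *ₚ h) (i ℕ.+ j)) (h< _ (s≤s (ℕ.m≤n+m j i))) ⟩
  a ℤ.* 0ℤ ℤ.+ coeff (g *ₚ h) (i ℕ.+ j)
    ≡⟨ cong (ℤ._+ coeff (g *ₚ h) (i ℕ.+ j)) (ℤ.*-zeroʳ a) ⟩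
  0ℤ ℤ.+ coeff (g *ₚ h) (i ℕ.+ j)
    ≡⟨ ℤ.+-identityˡ _ ⟩
  coeff (g *ₚ h) (i ℕ.+ j)
    ≡⟨ leading-* g h i j (λ i′ le → g< (suc i′) (s≤s le)) h< ⟩
  coeff g i ℤ.* coeff h j
    ∎
  where open ≡-Reasoning

-- A list may end in zeros, so its length does not give the degree; the last nonzero coefficient is
-- found by deciding equality in ℤ. `DegreeBelow 0` expresses that a polynomial is zero.
exactDegree : ∀ g → DegreeBelow 0 g ⊎ ∃ λ d → coeff g d ≢ 0ℤ × DegreeBelow (suc d) g
exactDegree [] = inj₁ (λ _ _ → ≡.refl)
exactDegree (a ∷ g) with exactDegree g
... | inj₂ (d , gd≢0 , g<) = inj₂ (suc d , gd≢0 , λ { (suc i) (s≤s le) → g< i le })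
... | inj₁ g≈0 with a ℤ.≟ 0ℤ
...   | yes a≡0 = inj₁ (λ { zero _ → a≡0 ; (suc i) _ → g≈0 i z≤n })
...   | no  a≢0 = inj₂ (zero , a≢0 , λ { (suc i) _ → g≈0 i z≤n })

-- ℤ is a domain, so degrees add: a nonconstant h would leave a nonzero product of leading
-- coefficients in positive degree, where 1 has coefficient 0.
unit⇒constant : ∀ g h → g *ₚ h ≈ₚ 1ℤ ∷ [] → DegreeBelow 1 h
unit⇒constant g h gh≈1 with exactDegree g | exactDegree h
... | inj₁ g≈0 | _ = contradiction (≡.trans (≡.sym (gh≈1 0)) (*ₚ-zeroˡ g h g≈0 0 z≤n)) λ ()
... | inj₂ _ | inj₁ h≈0 = λ i _ → h≈0 i z≤n
... | inj₂ _ | inj₂ (zero , _ , h<) = h<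
... | inj₂ (i , gi≢0 , g<) | inj₂ (suc j , hj≢0 , h<) =
  contradiction (ℤ.i*j≡0⇒i≡0∨j≡0 (coeff g i) product≡0) [ gi≢0 , hj≢0 ]′
  where
  1-constant : ∀ k → coeff (1ℤ ∷ []) (k ℕ.+ suc j) ≡ 0ℤ
  1-constant zero    = ≡.refl
  1-constant (suc k) = ≡.refl
  product≡0 : coeff g i ℤ.* coeff h (suc j) ≡ 0ℤ
  product≡0 = ≡.trans (≡.sym (leading-* g h i (suc j) g< h<))
                      (≡.trans (gh≈1 (i ℕ.+ suc j)) (1-constant i))

constant-*ₚ : ∀ {k} g h → DegreeBelow 1 g → DegreeBelow k h → DegreeBelow k (g *ₚ h)
constant-*ₚ []      h g< h< i le = ≡.refl
constant-*ₚ (a ∷ g) h g< h< i le = begin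
  coeff ((a ∷ g) *ₚ h) i                       ≡⟨ coeff-∷-* a g h i ⟩
  a ℤ.* coeff h i ℤ.+ coeff (0ℤ ∷ g *ₚ h) i    ≡⟨ cong₂ (λ y z → a ℤ.* y ℤ.+ z) (h< i le) (shifted i) ⟩
  a ℤ.* 0ℤ ℤ.+ 0ℤ                              ≡⟨ cong (ℤ._+ 0ℤ) (ℤ.*-zeroʳ a) ⟩
  0ℤ                                           ∎
  where
  open ≡-Reasoning
  shifted : ∀ j → coeff (0ℤ ∷ g *ₚ h) j ≡ 0ℤ
  shifted zero    = ≡.refl
  shifted (suc j) = *ₚ-zeroˡ g h (λ i _ → g< (suc i) (s≤s z≤n)) j z≤n

-- Divisibility by a prime, Gauss's lemma, and pseudo-division

infix 4 _∣ₚ_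
_∣ₚ_ : ℤ → ℤ[X] → Set
c ∣ₚ g = ∀ i → c Signed.∣ coeff g i

euclid : ∀ {p} → Prime p → ∀ a b → + p Signed.∣ a ℤ.* b → + p Signed.∣ a ⊎ + p Signed.∣ b
euclid {p} p-prime a b p∣ab
  with Primality.euclidsLemma ℤ.∣ a ∣ ℤ.∣ b ∣ p-prime
         (≡.subst (p ∣_) (ℤ.abs-* a b) (Signed.∣⇒∣ᵤ p∣ab))
... | inj₁ p∣a = inj₁ (Signed.∣ᵤ⇒∣ p∣a)
... | inj₂ p∣b = inj₂ (Signed.∣ᵤ⇒∣ p∣b)

-- Induction on the two lists replaces the search for the first coefficients prime to p. The product
-- of the constant terms is divisible by p, hence one of them is; dropping that term leaves a
-- shorter product that p still divides.
gauss : ∀ {p} → Prime p → ∀ g h → + p ∣ₚ (g *ₚ h) → + p ∣ₚ g ⊎ + p ∣ₚ h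
gauss     p-prime []      h       p∣gh = inj₁ (λ _ → Signed.divides 0ℤ ≡.refl)
gauss     p-prime (a ∷ g) []      p∣gh = inj₂ (λ _ → Signed.divides 0ℤ ≡.refl)
gauss {p} p-prime (a ∷ g) (b ∷ h) p∣gh =
  [ (λ p∣a → [ (λ p∣g → inj₁ λ { zero → p∣a ; (suc i) → p∣g i }) , inj₂ ]′
      (gauss p-prime g (b ∷ h) λ i →
        Signed.∣m+n∣m⇒∣n (≡.subst (+ p Signed.∣_) (coeff-∷-* a g (b ∷ h) (suc i)) (p∣gh (suc i)))
                         (Signed.∣m⇒∣m*n (coeff h i) p∣a)))
  , (λ p∣b → [ inj₁ , (λ p∣h → inj₂ λ { zero → p∣b ; (suc i) → p∣h i }) ]′
      (gauss p-prime (a ∷ g) h λ i →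
        Signed.∣m+n∣m⇒∣n (≡.subst (+ p Signed.∣_) (expand i) (p∣gh (suc i)))
                         (Signed.∣m⇒∣m*n (coeff g i) p∣b)))
  ]′ (euclid p-prime a b (≡.subst (+ p Signed.∣_) (ℤ.+-identityʳ (a ℤ.* b)) (p∣gh 0)))
  where
  expand : ∀ i → coeff ((a ∷ g) *ₚ (b ∷ h)) (suc i) ≡ b ℤ.* coeff g i ℤ.+ coeff ((a ∷ g) *ₚ h) i
  expand i = ≡.trans (*ₚ-∷ (a ∷ g) b h (suc i))
    (≡.trans (coeff-+ (b ·ₚ g) ((a ∷ g) *ₚ h) i) (cong (ℤ._+ _) (coeff-· b g i)))

∣ₚ⇒·ₚ : ∀ c g → c ∣ₚ g → ∃ λ h → g ≡ c ·ₚ h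
∣ₚ⇒·ₚ c []      c∣g = [] , ≡.refl
∣ₚ⇒·ₚ c (a ∷ g) c∣g with c∣g 0 | ∣ₚ⇒·ₚ c g (λ i → c∣g (suc i))
... | Signed.divides q eq | h , ≡.refl = q ∷ h , cong (_∷ c ·ₚ h) (≡.trans eq (ℤ.*-comm q c))

-- The divisor need not be monic, so each step costs a factor sₖ. From c g = q s + t, what remains
-- of c (a + X g) modulo s is w = c a + X t, of degree at most k, and sₖ w - wₖ s has lost its
-- coefficient at k.
pseudoDivision : ∀ k s → coeff s k ≢ 0ℤ → DegreeBelow (suc k) s → ∀ g →
  ∃ λ c → c ≢ 0ℤ × ∃₂ λ q t → DegreeBelow k t × c ·ₚ g ≈ₚ q *ₚ s +ₚ t
pseudoDivision k s sₖ≢0 s< [] =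
  1ℤ , (λ ()) , [] , [] , (λ _ _ → ≡.refl) , λ _ → ≡.refl
pseudoDivision k s sₖ≢0 s< (a ∷ g) with pseudoDivision k s sₖ≢0 s< g
... | c , c≢0 , q , t , t< , cg≈qs+t =
  sₖ ℤ.* c , (λ eq → [ sₖ≢0 , c≢0 ]′ (ℤ.i*j≡0⇒i≡0∨j≡0 sₖ eq)) ,
  wₖ ∷ sₖ ·ₚ q , t′ , t′< , identity
  where
  open +-*-Solver
  sₖ = coeff s k
  w = (c ℤ.* a) ∷ t
  wₖ = coeff w k
  t′ = sₖ ·ₚ w +ₚ (ℤ.- wₖ) ·ₚ s

  coeff-t′ : ∀ i → coeff t′ i ≡ sₖ ℤ.* coeff w i ℤ.+ (ℤ.- wₖ) ℤ.* coeff s i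
  coeff-t′ i = ≡.trans (coeff-+ (sₖ ·ₚ w) ((ℤ.- wₖ) ·ₚ s) i)
                       (cong₂ ℤ._+_ (coeff-· sₖ w i) (coeff-· (ℤ.- wₖ) s i))

  w< : DegreeBelow (suc k) w
  w< (suc i) (s≤s le) = t< i le

  t′< : DegreeBelow k t′
  t′< i k≤i with ℕ.m≤n⇒m<n∨m≡n k≤i
  ... | inj₂ ≡.refl = ≡.trans (coeff-t′ k)
    (solve 2 (λ x y → x :* y :+ :- y :* x := con 0ℤ) ≡.refl sₖ wₖ)
  ... | inj₁ k<i = ≡.trans (coeff-t′ i)
    (≡.trans (cong₂ (λ y z → sₖ ℤ.* y ℤ.+ (ℤ.- wₖ) ℤ.* z) (w< i k<i) (s< i k<i))
             (solve 2 (λ x y → x :* con 0ℤ :+ :- y :* con 0ℤ := con 0ℤ) ≡.refl sₖ wₖ))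

  coeff-q′s : ∀ i → coeff ((wₖ ∷ sₖ ·ₚ q) *ₚ s +ₚ t′) i ≡
    wₖ ℤ.* coeff s i ℤ.+ coeff (0ℤ ∷ (sₖ ·ₚ q) *ₚ s) i ℤ.+
    (sₖ ℤ.* coeff w i ℤ.+ (ℤ.- wₖ) ℤ.* coeff s i)
  coeff-q′s i = ≡.trans (coeff-+ ((wₖ ∷ sₖ ·ₚ q) *ₚ s) t′ i)
    (cong₂ ℤ._+_ (coeff-∷-* wₖ (sₖ ·ₚ q) s i) (coeff-t′ i))

  identity : (sₖ ℤ.* c) ·ₚ (a ∷ g) ≈ₚ (wₖ ∷ sₖ ·ₚ q) *ₚ s +ₚ t′
  identity zero = ≡.sym (≡.trans (coeff-q′s 0)
    (solve 5 (λ w s₀ sₖ c a → w :* s₀ :+ con 0ℤ :+ (sₖ :* (c :* a) :+ :- w :* s₀) := sₖ :* c :* a)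
       ≡.refl wₖ (coeff s 0) sₖ c a))
  identity (suc i) = begin
    coeff ((sₖ ℤ.* c) ·ₚ g) i
      ≡⟨ coeff-· (sₖ ℤ.* c) g i ⟩
    sₖ ℤ.* c ℤ.* coeff g i
      ≡⟨ ℤ.*-assoc sₖ c _ ⟩
    sₖ ℤ.* (c ℤ.* coeff g i)
      ≡⟨ cong (sₖ ℤ.*_) (≡.trans (≡.sym (coeff-· c g i)) (≡.trans (cg≈qs+t i) (coeff-+ (q *ₚ s) t i))) ⟩
    sₖ ℤ.* (coeff (q *ₚ s) i ℤ.+ coeff t i)
      ≡⟨ solve 5 (λ w s′ sₖ x t → sₖ :* (x :+ t) := w :* s′ :+ sₖ :* x :+ (sₖ :* t :+ :- w :* s′))
           ≡.refl wₖ (coeff s (suc i)) sₖ (coeff (q *ₚ s) i) (coeff t i) ⟩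
    wₖ ℤ.* coeff s (suc i) ℤ.+ sₖ ℤ.* coeff (q *ₚ s) i ℤ.+
    (sₖ ℤ.* coeff t i ℤ.+ (ℤ.- wₖ) ℤ.* coeff s (suc i))
      ≡⟨ cong (λ z → wₖ ℤ.* coeff s (suc i) ℤ.+ z ℤ.+ (sₖ ℤ.* coeff t i ℤ.+ (ℤ.- wₖ) ℤ.* coeff s (suc i)))
           (≡.trans (≡.sym (coeff-· sₖ (q *ₚ s) i)) (≡.sym (·ₚ-*ₚ-assoc sₖ q s i))) ⟩
    _
      ≡⟨ coeff-q′s (suc i) ⟨
    coeff ((wₖ ∷ sₖ ·ₚ q) *ₚ s +ₚ t′) (suc i)
      ∎
    where open ≡-Reasoning

-- Division by X - r

-- syntheticQuotient r g is (g − g(r)) / (X − r).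
syntheticQuotient : ℤ → ℤ[X] → ℤ[X]
syntheticQuotient r []      = []
syntheticQuotient r (a ∷ g) = evalℤ g r ∷ syntheticQuotient r g

evalℤ-zero : ∀ g r → DegreeBelow 0 g → evalℤ g r ≡ 0ℤ
evalℤ-zero []      r g≈0 = ≡.refl
evalℤ-zero (a ∷ g) r g≈0 = ≡.trans
  (cong₂ (λ y z → y ℤ.+ r ℤ.* z) (g≈0 0 z≤n) (evalℤ-zero g r (λ i _ → g≈0 (suc i) z≤n)))
  (≡.trans (ℤ.+-identityˡ _) (ℤ.*-zeroʳ r))

syntheticQuotient-zero : ∀ r g → DegreeBelow 0 g → DegreeBelow 0 (syntheticQuotient r g)
syntheticQuotient-zero r []      g≈0 i       _ = ≡.refl
syntheticQuotient-zero r (a ∷ g) g≈0 zero    _ = evalℤ-zero g r (λ i _ → g≈0 (suc i) z≤n)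
syntheticQuotient-zero r (a ∷ g) g≈0 (suc i) _ =
  syntheticQuotient-zero r g (λ i _ → g≈0 (suc i) z≤n) i z≤n

syntheticQuotient-monic : ∀ d r g →
  MonicOfDegree (suc d) g → MonicOfDegree d (syntheticQuotient r g)
syntheticQuotient-monic zero    r (a ∷ b ∷ g) (b≡1 , g<) =
  ≡.trans (cong₂ (λ y z → y ℤ.+ r ℤ.* z) b≡1 (evalℤ-zero g r g≈0)) (cong (λ z → 1ℤ ℤ.+ z) (ℤ.*-zeroʳ r)) ,
  λ { (suc zero) _ → evalℤ-zero g r g≈0
    ; (suc (suc i)) _ → syntheticQuotient-zero r g g≈0 i z≤n }
  where
  g≈0 : DegreeBelow 0 g
  g≈0 i _ = g< (suc (suc i)) (s≤s (s≤s z≤n))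
syntheticQuotient-monic (suc d) r (a ∷ g) (g≡1 , g<)
  with syntheticQuotient-monic d r g (g≡1 , λ i lt → g< (suc i) (s≤s lt))
... | q≡1 , q< = q≡1 , λ { (suc i) (s≤s lt) → q< i lt }

-- At k = 0 this is the product rule for X g: `weighted 1 g` is (X g)′ and `weighted 0 g` is X g′.
-- The induction needs general k.
evalℤ-weighted : ∀ k g r → evalℤ (weighted (suc k) g) r ≡ evalℤ g r ℤ.+ evalℤ (weighted k g) r
evalℤ-weighted k []      r = ≡.refl
evalℤ-weighted k (a ∷ g) r = ≡.trans
  (cong (λ z → + suc k ℤ.* a ℤ.+ r ℤ.* z) (evalℤ-weighted (suc k) g r))
  (solve 5 (λ k a r x y → (con 1ℤ :+ k) :* a :+ r :* (x :+ y) := (a :+ r :* x) :+ (k :* a :+ r :* y))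
    ≡.refl (+ k) a r (evalℤ g r) (evalℤ (weighted (suc k) g) r))
  where open +-*-Solver

-- Differentiating g = g(r) + (X - r) q at r leaves q(r). The induction compares recursions instead:
-- on both sides the value for a + X g is g(r) plus r times the value for g.
evalℤ-syntheticQuotient : ∀ r g → evalℤ (syntheticQuotient r g) r ≡ evalℤ (derivative g) r
evalℤ-syntheticQuotient r []          = ≡.refl
evalℤ-syntheticQuotient r (a ∷ [])    = ≡.trans (ℤ.+-identityˡ _) (ℤ.*-zeroʳ r)
evalℤ-syntheticQuotient r (a ∷ b ∷ g) = ≡.trans
  (cong (λ z → evalℤ (b ∷ g) r ℤ.+ r ℤ.* z) (evalℤ-syntheticQuotient r (b ∷ g)))
  (≡.trans
    (cong (λ z → evalℤ (b ∷ g) r ℤ.+ z) (≡.sym (ℤ.+-identityˡ _)))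
    (≡.sym (evalℤ-weighted 0 (b ∷ g) r)))

-- Integers inside ℚ, and coprimality

/1-homo-* : ∀ a b → (a ℤ.* b) / 1 ≡ (a / 1) ℚ.* (b / 1)
/1-homo-* a b = ℚ.toℚᵘ-injective (begin
  ℚ.toℚᵘ ((a ℤ.* b) / 1)
    ≈⟨ ℚ.toℚᵘ-fromℚᵘ (mkℚᵘ (a ℤ.* b) 0) ⟩
  mkℚᵘ a 0 ℚᵘ.* mkℚᵘ b 0
    ≈⟨ ℚᵘ.*-cong (ℚ.toℚᵘ-fromℚᵘ (mkℚᵘ a 0)) (ℚ.toℚᵘ-fromℚᵘ (mkℚᵘ b 0)) ⟨
  ℚ.toℚᵘ (a / 1) ℚᵘ.* ℚ.toℚᵘ (b / 1)
    ≈⟨ ℚ.toℚᵘ-homo-* (a / 1) (b / 1) ⟨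
  ℚ.toℚᵘ ((a / 1) ℚ.* (b / 1))
    ∎)
  where open SetoidReasoning ℚᵘ.≃-setoid

/1-inverse : ∀ k → (+ suc k) / 1 ℚ.* (1ℤ / suc k) ≡ ℚ.1ℚ
/1-inverse k = ℚ.toℚᵘ-injective (begin
  ℚ.toℚᵘ ((+ suc k) / 1 ℚ.* (1ℤ / suc k))
    ≈⟨ ℚ.toℚᵘ-homo-* ((+ suc k) / 1) (1ℤ / suc k) ⟩
  ℚ.toℚᵘ ((+ suc k) / 1) ℚᵘ.* ℚ.toℚᵘ (1ℤ / suc k)
    ≈⟨ ℚᵘ.*-cong (ℚ.toℚᵘ-fromℚᵘ (mkℚᵘ (+ suc k) 0)) (ℚ.toℚᵘ-fromℚᵘ (mkℚᵘ 1ℤ k)) ⟩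
  mkℚᵘ (+ suc k) 0 ℚᵘ.* mkℚᵘ 1ℤ k
    ≈⟨ *≡* (≡.trans (ℤ.*-identityʳ _) (≡.trans (ℤ.*-identityʳ _)
         (≡.sym (≡.trans (ℤ.*-identityˡ _) (cong (λ z → + suc z) (ℕ.+-identityʳ k)))))) ⟩
  ℚ.toℚᵘ ℚ.1ℚ
    ∎)
  where open SetoidReasoning ℚᵘ.≃-setoid

prime∤⇒coprime : ∀ {p m} → Prime p → ¬ p ∣ m → Coprime m p
prime∤⇒coprime p-prime p∤m (d∣m , d∣p) with Primality.prime⇒irreducible p-prime d∣p
... | inj₁ d≡1    = d≡1
... | inj₂ ≡.refl = contradiction d∣m p∤m

module ExtensionProperties {c ℓ₁ ℓ₂} (K : ExtensionOfℚ c ℓ₁ ℓ₂) where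
  open Extension K
  private
    module R = CommutativeRing commutativeRing
    module ι = IsRingHomomorphism ι-homo
  open SetoidReasoning R.setoid
  open RingProperties R.ring using (-‿distribʳ-*)
  open AbelianGroupProperties R.+-abelianGroup using (ε⁻¹≈ε)
  open Exp R.semiring using (^-homo-*) renaming (_^_ to _^ᴷ_)

  open Sum R.+-commutativeMonoid using (sum; sum-permute; sum-cong-≋; ∑-distrib-+; sum-replicate)
  open Mult R.+-monoid using (×-assocˡ) renaming (_×_ to _×ᴷ_)

  fromℤ-* : ∀ a b → fromℤ (a ℤ.* b) ≈ fromℤ a * fromℤ b
  fromℤ-* a b = R.trans (ι.⟦⟧-cong (/1-homo-* a b)) (ι.*-homo (a / 1) (b / 1))

  fromℤ-inverse : ∀ k → fromℤ (+ suc k) * ι (1ℤ / suc k) ≈ 1#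
  fromℤ-inverse k = R.trans (R.sym (ι.*-homo _ _)) (R.trans (ι.⟦⟧-cong (/1-inverse k)) ι.1#-homo)

  almostCommutativeRing : AlmostCommutativeRing c ℓ₁
  almostCommutativeRing = fromCommutativeRing commutativeRing

  -- The ring solver has to compare constants, which is possible in ℤ but not in K; hence its
  -- coefficients are integers.
  fromℤ-morphism : ℤ.+-*-rawRing -Raw-AlmostCommutative⟶ almostCommutativeRing
  fromℤ-morphism = record
    { ⟦_⟧    = fromℤ
    ; +-homo = fromℤ-+
    ; *-homo = fromℤ-*
    ; -‿homo = fromℤ-neg
    ; 0-homo = ι.0#-homo
    ; 1-homo = ι.1#-homo
    }

  fromℤ-≟ : WeaklyDecidable (Induced-equivalence fromℤ-morphism)
  fromℤ-≟ a b with a ℤ.≟ b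
  ... | yes ≡.refl = just R.refl
  ... | no  _      = nothing

  open RingSolver ℤ.+-*-rawRing almostCommutativeRing fromℤ-morphism fromℤ-≟
    using (solve; _:=_; _:+_; _:*_; _:-_; :-_; con)

  -- Integral elements over a subring

  -- Kept apart from `Subring` because spans, and polynomials of bounded degree in an element, are
  -- closed under sums but in general not under products.
  record Additive {a} (A : Pred Carrier a) : Set (c ⊔ ℓ₁ ⊔ a) where
    field
      ≈-closed : ∀ {x y} → x ≈ y → A x → A y
      0-closed : A 0#
      +-closed : ∀ {x y} → A x → A y → A (x + y)
      -‿closed : ∀ {x} → A x → A (- x)

    minus-closed : ∀ {x y} → A x → A y → A (x - y)
    minus-closed Ax Ay = +-closed Ax (-‿closed Ay)

  record Subring {a} (A : Pred Carrier a) : Set (c ⊔ ℓ₁ ⊔ a) where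
    field
      additive : Additive A
      1-closed : A 1#
      *-closed : ∀ {x y} → A x → A y → A (x * y)
    open Additive additive public

  -- A is an arbitrary predicate, so that spans can serve as coefficients of further spans. The
  -- highest generator comes first, the one that `eliminate` removes; m is defined on all of ℕ so
  -- that k can vary.
  data Span {a} (A : Pred Carrier a) (m : ℕ → Carrier) : ℕ → Pred Carrier (c ⊔ ℓ₁ ⊔ a) where
    nil  : ∀ {v} → v ≈ 0# → Span A m 0 v
    cons : ∀ {k v a w} → A a → Span A m k w → v ≈ a * m k + w → Span A m (suc k) v

  module _ {a} {A : Pred Carrier a} {m : ℕ → Carrier} (A-additive : Additive A) where
    open Additive A-additive

    private
      span-≈ : ∀ {k x y} → x ≈ y → Span A m k x → Span A m k y
      span-≈ x≈y (nil x≈0)          = nil (R.trans (R.sym x≈y) x≈0)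
      span-≈ x≈y (cons Aa w∈ x≈am+w) = cons Aa w∈ (R.trans (R.sym x≈y) x≈am+w)

      span-0 : ∀ k → Span A m k 0#
      span-0 zero    = nil R.refl
      span-0 (suc k) = cons 0-closed (span-0 k)
        (R.sym (R.trans (R.+-identityʳ _) (R.zeroˡ _)))

      span-+ : ∀ {k x y} → Span A m k x → Span A m k y → Span A m k (x + y)
      span-+ (nil x≈0) (nil y≈0) = nil (R.trans (R.+-cong x≈0 y≈0) (R.+-identityˡ 0#))
      span-+ (cons Aa w∈ x≈) (cons Ab u∈ y≈) = cons (+-closed Aa Ab) (span-+ w∈ u∈)
        (R.trans (R.+-cong x≈ y≈)
          (solve 5 (λ a b m w u → (a :* m :+ w) :+ (b :* m :+ u) := (a :+ b) :* m :+ (w :+ u))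
            R.refl _ _ _ _ _))

      span-neg : ∀ {k x} → Span A m k x → Span A m k (- x)
      span-neg (nil x≈0) = nil (R.trans (R.-‿cong x≈0) ε⁻¹≈ε)
      span-neg (cons Aa w∈ x≈) = cons (-‿closed Aa) (span-neg w∈)
        (R.trans (R.-‿cong x≈)
          (solve 3 (λ a m w → :- (a :* m :+ w) := :- a :* m :+ :- w) R.refl _ _ _))

    span-additive : ∀ k → Additive (Span A m k)
    span-additive k = record
      { ≈-closed = span-≈ ; 0-closed = span-0 k ; +-closed = span-+ ; -‿closed = span-neg }

    span-generator : ∀ {k i x} → i < k → A x → Span A m k (x * m i)
    span-generator {suc k} (s≤s i≤k) Ax with ℕ.m≤n⇒m<n∨m≡n i≤k
    ... | inj₂ ≡.refl = cons Ax (span-0 k) (R.sym (R.+-identityʳ _))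
    ... | inj₁ i<k    = cons 0-closed (span-generator i<k Ax)
      (R.sym (R.trans (R.+-congʳ (R.zeroˡ _)) (R.+-identityˡ _)))

  span-elim : ∀ {a q} {A : Pred Carrier a} {Q : Pred Carrier q} {m k} → Additive Q →
    (∀ {i x} → i < k → A x → Q (x * m i)) → Span A m k ⊆ Q
  span-elim Q-additive gen (nil v≈0) = ≈-closed (R.sym v≈0) 0-closed
    where open Additive Q-additive
  span-elim Q-additive gen (cons Aa w∈ v≈) = ≈-closed (R.sym v≈)
    (+-closed (gen ℕ.≤-refl Aa) (span-elim Q-additive (λ i<k → gen (ℕ.m<n⇒m<1+n i<k)) w∈))
    where open Additive Q-additive

  -- As a target of `span-elim`, this reduces a claim about b v, for v in a span, to the generators.
  scaled-additive : ∀ {q} {Q : Pred Carrier q} → Additive Q → ∀ b → Additive (λ x → Q (b * x))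
  scaled-additive Q-additive b = record
    { ≈-closed = λ x≈y → ≈-closed (R.*-congˡ x≈y)
    ; 0-closed = ≈-closed (R.sym (R.zeroʳ b)) 0-closed
    ; +-closed = λ Qx Qy → ≈-closed (R.sym (R.distribˡ b _ _)) (+-closed Qx Qy)
    ; -‿closed = λ Qx → ≈-closed (-‿distribʳ-* b _) (-‿closed Qx)
    }
    where open Additive Q-additive

  span-mono : ∀ {a b} {A : Pred Carrier a} {B : Pred Carrier b} {m k l} → Additive B →
    A ⊆ B → k ≤ l → Span A m k ⊆ Span B m l
  span-mono B-additive A⊆B k≤l =
    span-elim (span-additive B-additive _)
      (λ i<k Ax → span-generator B-additive (ℕ.<-≤-trans i<k k≤l) (A⊆B Ax))

  span-scale : ∀ {a b} {A : Pred Carrier a} {B : Pred Carrier b} {m k y} → Additive B →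
    (∀ {x} → A x → B (y * x)) → ∀ {v} → Span A m k v → Span B m k (y * v)
  span-scale B-additive scale =
    span-elim (scaled-additive (span-additive B-additive _) _)
      (λ i<k Ax → ≈-closed (R.*-assoc _ _ _) (span-generator B-additive i<k (scale Ax)))
    where open Additive (span-additive B-additive _)

  -- Exchange of the summations in Σᵢ (Σⱼ aᵢⱼ mⱼ) nᵢ. It turns polynomials in x with coefficients
  -- polynomial in y into polynomials in y with coefficients polynomial in x.
  span-transpose : ∀ {a} {A : Pred Carrier a} {m n k l} → Additive A →
    Span (Span A m k) n l ⊆ Span (Span A n l) m k
  span-transpose {m = m} {n} {k} {l} A-additive =
    span-elim target λ {i} i<l u∈ →
      ≈-closed (R.*-comm _ _)
        (span-elim (scaled-additive target (n i))
          (λ {j} j<k Aa → ≈-closed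
            (solve 3 (λ a mj ni → a :* ni :* mj := ni :* (a :* mj)) R.refl _ (m j) (n i))
            (span-generator (span-additive A-additive l) j<k (span-generator A-additive i<l Aa)))
          u∈)
    where
    target = span-additive (span-additive A-additive l) k
    open Additive target

  -- Polynomials of bounded degree in one element, and integrality

  LowDegree : ∀ {a} → Pred Carrier a → Carrier → ℕ → Pred Carrier (c ⊔ ℓ₁ ⊔ a)
  LowDegree A x = Span A (x ^ᴷ_)

  -- A monic equation of degree d, solved for its top power. A is any predicate, as the coefficients
  -- will also be taken from a span.
  IntegralOver : ∀ {a} → Pred Carrier a → Pred Carrier (c ⊔ ℓ₁ ⊔ a)
  IntegralOver A x = ∃ λ d → LowDegree A x d (x ^ᴷ d)

  module _ {a} {A : Pred Carrier a} (A-subring : Subring A) where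
    open Subring A-subring

    low-additive : ∀ x d → Additive (LowDegree A x d)
    low-additive x d = span-additive additive d

    low-^ : ∀ x d e {v} → LowDegree A x e v → LowDegree A x (d ℕ.+ e) (x ^ᴷ d * v)
    low-^ x d e =
      span-elim (scaled-additive (low-additive x (d ℕ.+ e)) _) λ {i} i<e Ab →
        Additive.≈-closed (low-additive x (d ℕ.+ e))
          (R.trans (R.*-congˡ (^-homo-* x d i))
            (solve 3 (λ b xd xi → b :* (xd :* xi) := xd :* (b :* xi)) R.refl _ (x ^ᴷ d) (x ^ᴷ i)))
          (span-generator additive (ℕ.+-monoʳ-< d i<e) Ab)

    -- The bound is not sharp, but for d = e it is the one that fits below the top power x^(d + d)
    -- of `eliminate`.
    low-* : ∀ {x d e u v} → LowDegree A x d u → LowDegree A x e v → LowDegree A x (d ℕ.+ e) (u * v)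
    low-* {x} {d} {e} {u} {v} u∈ v∈ =
      Additive.≈-closed (low-additive x (d ℕ.+ e)) (R.*-comm v u)
        (span-elim (scaled-additive (low-additive x (d ℕ.+ e)) v)
          (λ {i} {b} i<d Ab →
            Additive.≈-closed (low-additive x (d ℕ.+ e))
              (solve 3 (λ b xi v → b :* (xi :* v) := v :* (b :* xi)) R.refl b (x ^ᴷ i) v)
              (span-mono additive (λ Az → Az) (ℕ.+-monoˡ-≤ e (ℕ.<⇒≤ i<d))
                (span-scale additive (*-closed Ab) (low-^ x i e v∈))))
          u∈)

    -- Fraction-free elimination of the top generator: from (xᵈ − l) mₖ = w the
    -- remaining relations are multiplied by xᵈ − l, which stays monic in x.
    eliminate : ∀ x (m : ℕ → Carrier) k d →
      (∀ i → i ≤ k → Span (LowDegree A x d) m (suc k) (x ^ᴷ d * m i)) →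
      ∃ λ e → Span (LowDegree A x e) m 1 (x ^ᴷ e * m 0)
    eliminate x m zero    d rel = d , rel 0 z≤n
    eliminate x m (suc k) d rel with rel (suc k) ℕ.≤-refl
    ... | cons {a = l} {w = w} l∈ w∈ xᵈm≈lm+w = eliminate x m k (d ℕ.+ d) rel′
      where
      target = span-additive {m = m} (low-additive x (d ℕ.+ d)) (suc k)
      open Additive target using () renaming
        (≈-closed to ≈-closed′; +-closed to +-closed′; minus-closed to minus-closed′)

      rel′ : ∀ i → i ≤ k → Span (LowDegree A x (d ℕ.+ d)) m (suc k) (x ^ᴷ (d ℕ.+ d) * m i)
      rel′ i i≤k with rel i (ℕ.m≤n⇒m≤1+n i≤k)
      ... | cons {a = lᵢ} {w = wᵢ} lᵢ∈ wᵢ∈ xᵈmᵢ≈ =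
        ≈-closed′ identity
          (+-closed′
            (+-closed′ (span-generator (low-additive x (d ℕ.+ d)) (s≤s i≤k) (low-^ x d d l∈))
                       (span-scale (low-additive x (d ℕ.+ d)) (low-* lᵢ∈) w∈))
            (minus-closed′ (span-scale (low-additive x (d ℕ.+ d)) (low-^ x d d) wᵢ∈)
                       (span-scale (low-additive x (d ℕ.+ d)) (low-* l∈) wᵢ∈)))
        where
        X = x ^ᴷ d
        M = m (suc k)
        identity : (X * l) * m i + lᵢ * w + (X * wᵢ - l * wᵢ) ≈ x ^ᴷ (d ℕ.+ d) * m i
        identity = begin
          (X * l) * m i + lᵢ * w + (X * wᵢ - l * wᵢ)
            ≈⟨ R.+-congʳ (R.+-congˡ (R.*-congˡ
                 (R.trans (solve 2 (λ w t → w := (t :+ w) :- t) R.refl w (l * M))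
                          (R.+-congʳ (R.sym xᵈm≈lm+w))))) ⟩
          (X * l) * m i + lᵢ * (X * M - l * M) + (X * wᵢ - l * wᵢ)
            ≈⟨ solve 6 (λ X l mi li M wi →
                 X :* l :* mi :+ li :* (X :* M :- l :* M) :+ (X :* wi :- l :* wi) :=
                 l :* (X :* mi) :+ (X :- l) :* (li :* M :+ wi)) R.refl X l (m i) lᵢ M wᵢ ⟩
          l * (X * m i) + (X - l) * (lᵢ * M + wᵢ)
            ≈⟨ R.+-congˡ (R.*-congˡ xᵈmᵢ≈) ⟨
          l * (X * m i) + (X - l) * (X * m i)
            ≈⟨ solve 3 (λ l X mi → l :* (X :* mi) :+ (X :- l) :* (X :* mi) := X :* X :* mi)
                 R.refl l X (m i) ⟩
          X * X * m i
            ≈⟨ R.*-congʳ (^-homo-* x d d) ⟨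
          x ^ᴷ (d ℕ.+ d) * m i
            ∎

    -- Only the top power can overflow, and the monic relation rewrites it.
    low-closed-under-generator : ∀ {y e v} → LowDegree A y e (y ^ᴷ e) →
      LowDegree A y e v → LowDegree A y e (y * v)
    low-closed-under-generator {y} {e} yᵉ∈ =
      span-elim (scaled-additive (low-additive y e) y) λ {i} {b} i<e Ab →
        Additive.≈-closed (low-additive y e)
          (solve 3 (λ b y z → b :* (y :* z) := y :* (b :* z)) R.refl b y (y ^ᴷ i))
          (next i<e Ab)
      where
      next : ∀ {i b} → i < e → A b → LowDegree A y e (b * (y * y ^ᴷ i))
      next i<e Ab with ℕ.m≤n⇒m<n∨m≡n i<e
      ... | inj₁ 1+i<e  = span-generator additive 1+i<e Ab
      ... | inj₂ ≡.refl = span-scale additive (*-closed Ab) yᵉ∈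

    -- Multiplying the equation of x by 1, y, ..., yᵏ and exchanging summations gives k + 1
    -- relations xᵈ yⁱ = Σⱼ lᵢⱼ yʲ, with lᵢⱼ of degree below d in x. Eliminating yᵏ, ..., y leaves a
    -- monic equation for x on the generator 1; this replaces the usual determinant of xᵈ - (lᵢⱼ).
    integral-trans : ∀ {x y e} → LowDegree A y e (y ^ᴷ e) →
      IntegralOver (LowDegree A y e) x → IntegralOver A x
    -- A monic relation of degree 0 says 1 ≈ 0, which is also a relation of degree 0 for x.
    integral-trans {e = zero}  (nil 1≈0) _ = 0 , nil 1≈0
    integral-trans {x} {y} {suc k} yᵉ∈ (d , xᵈ∈) =
      let E , xᴱ∈ = eliminate x (y ^ᴷ_) k d relation in E , constant xᴱ∈
      where
      open Additive (low-additive y (suc k)) using () renaming (≈-closed to ≈-closed′)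

      power : ∀ i {v} → LowDegree A y (suc k) v → LowDegree A y (suc k) (y ^ᴷ i * v)
      power zero    v∈ = ≈-closed′ (R.sym (R.*-identityˡ _)) v∈
      power (suc i) v∈ = ≈-closed′ (R.sym (R.*-assoc _ _ _))
        (low-closed-under-generator yᵉ∈ (power i v∈))

      relation : ∀ i → i ≤ k → Span (LowDegree A x d) (y ^ᴷ_) (suc k) (x ^ᴷ d * y ^ᴷ i)
      relation i _ = span-transpose additive
        (Additive.≈-closed (span-additive (low-additive y (suc k)) d) (R.*-comm _ _)
          (span-scale (low-additive y (suc k)) (power i) xᵈ∈))

      constant : ∀ {E} → Span (LowDegree A x E) (y ^ᴷ_) 1 (x ^ᴷ E * 1#) → LowDegree A x E (x ^ᴷ E)
      constant {E} (cons {a = l} l∈ (nil w≈0) xᴱ≈) = Additive.≈-closed (low-additive x E)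
        (R.sym (R.trans (R.sym (R.*-identityʳ _)) (R.trans xᴱ≈
          (R.trans (R.+-cong (R.*-identityʳ _) w≈0) (R.+-identityʳ l)))))
        l∈

    -- With z = x + b, each step multiplies zᵏ + l by x = z - b, which keeps the leading coefficient
    -- 1.
    translate-^ : ∀ {x b} → A b → ∀ k → ∃ λ l →
      LowDegree A (x + b) k l × x ^ᴷ k ≈ (x + b) ^ᴷ k + l
    translate-^ Ab zero = 0# , nil R.refl , R.sym (R.+-identityʳ 1#)
    translate-^ {x} {b} Ab (suc k) with translate-^ {x} {b} Ab k
    ... | l , l∈ , xᵏ≈ =
      z * l - b * (z ^ᴷ k + l) ,
      minus-closed′
        (≈-closed′ (R.*-congʳ (R.*-identityʳ z)) (low-^ z 1 k l∈))
        (span-scale additive (*-closed Ab)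
          (+-closed′ (≈-closed′ (R.*-identityˡ _) (span-generator additive ℕ.≤-refl 1-closed))
                     (span-mono additive (λ Ac → Ac) (ℕ.n≤1+n k) l∈))) ,
      (begin
        x * x ^ᴷ k
          ≈⟨ R.*-congˡ xᵏ≈ ⟩
        x * (z ^ᴷ k + l)
          ≈⟨ solve 4 (λ x b zk l → x :* (zk :+ l) :=
               (x :+ b) :* zk :+ ((x :+ b) :* l :- b :* (zk :+ l))) R.refl x b (z ^ᴷ k) l ⟩
        z * z ^ᴷ k + (z * l - b * (z ^ᴷ k + l))
          ∎)
      where
      z = x + b
      open Additive (low-additive z (suc k)) using () renaming
        (≈-closed to ≈-closed′; +-closed to +-closed′; minus-closed to minus-closed′)

    translate-integral : ∀ {x b} → A b → IntegralOver A x → IntegralOver A (x + b)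
    translate-integral {x} {b} Ab (d , xᵈ∈) with translate-^ {x} {b} Ab d
    ... | l , l∈ , xᵈ≈ = d ,
      ≈-closed′ (R.trans (R.+-congʳ xᵈ≈) (solve 2 (λ u l → (u :+ l) :- l := u) R.refl _ l))
        (minus-closed′ (span-elim (low-additive z d) power xᵈ∈) l∈)
      where
      z = x + b
      open Additive (low-additive z d) using () renaming
        (≈-closed to ≈-closed′; +-closed to +-closed′; minus-closed to minus-closed′)
      power : ∀ {i a} → i < d → A a → LowDegree A z d (a * x ^ᴷ i)
      power {i} i<d Aa with translate-^ {x} {b} Ab i
      ... | lᵢ , lᵢ∈ , xⁱ≈ = span-scale additive (*-closed Aa)
        (≈-closed′ (R.sym xⁱ≈)
          (+-closed′ (≈-closed′ (R.*-identityˡ _) (span-generator additive i<d 1-closed))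
                     (span-mono additive (λ Ac → Ac) (ℕ.<⇒≤ i<d) lᵢ∈)))

  -- Evaluation and the rings ℤ[θ] and 𝒪

  fromℤ-0 : fromℤ 0ℤ ≈ 0#
  fromℤ-0 = ι.0#-homo

  fromℤ-1 : fromℤ 1ℤ ≈ 1#
  fromℤ-1 = ι.1#-homo

  -- If 1 ≈ 0, all elements equal 1, so 0 - 0 is invertible and 0 is apart from itself, against
  -- irreflexivity of apartness.
  1≉0 : ¬ 1# ≈ 0#
  1≉0 1≈0 = F.#-irrefl (R.refl {0#}) (F.invertible⇒# (0# , collapse _ , collapse _))
    where
    module F = HeytingField heytingField
    collapse : ∀ x → x ≈ 1#
    collapse x = begin
      x       ≈⟨ R.*-identityˡ x ⟨
      1# * x  ≈⟨ R.*-congʳ 1≈0 ⟩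
      0# * x  ≈⟨ R.zeroˡ x ⟩
      0#      ≈⟨ 1≈0 ⟨
      1#      ∎

  eval-zero : ∀ g x → DegreeBelow 0 g → eval g x ≈ 0#
  eval-zero []      x g≈0 = R.refl
  eval-zero (a ∷ g) x g≈0 = begin
    fromℤ a + x * eval g x  ≈⟨ R.+-cong (R.reflexive (cong fromℤ (g≈0 0 z≤n)))
                                        (R.*-congˡ (eval-zero g x λ i _ → g≈0 (suc i) z≤n)) ⟩
    fromℤ 0ℤ + x * 0#       ≈⟨ R.+-cong fromℤ-0 (R.zeroʳ x) ⟩
    0# + 0#                 ≈⟨ R.+-identityˡ 0# ⟩
    0#                      ∎

  eval-≈ₚ : ∀ g h x → g ≈ₚ h → eval g x ≈ eval h x
  eval-≈ₚ []      h       x g≈h = R.sym (eval-zero h x λ i _ → ≡.sym (g≈h i))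
  eval-≈ₚ (a ∷ g) []      x g≈h = eval-zero (a ∷ g) x λ i _ → g≈h i
  eval-≈ₚ (a ∷ g) (b ∷ h) x g≈h =
    R.+-cong (R.reflexive (cong fromℤ (g≈h 0))) (R.*-congˡ (eval-≈ₚ g h x λ i → g≈h (suc i)))

  eval-· : ∀ a g x → eval (a ·ₚ g) x ≈ fromℤ a * eval g x
  eval-· a []      x = R.sym (R.zeroʳ _)
  eval-· a (b ∷ g) x = begin
    fromℤ (a ℤ.* b) + x * eval (a ·ₚ g) x
      ≈⟨ R.+-cong (fromℤ-* a b) (R.*-congˡ (eval-· a g x)) ⟩
    fromℤ a * fromℤ b + x * (fromℤ a * eval g x)
      ≈⟨ solve 4 (λ a b x y → a :* b :+ x :* (a :* y) := a :* (b :+ x :* y)) R.refl _ _ x _ ⟩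
    fromℤ a * (fromℤ b + x * eval g x)
      ∎

  eval-* : ∀ g h x → eval (g *ₚ h) x ≈ eval g x * eval h x
  eval-* []      h x = R.sym (R.zeroˡ _)
  eval-* (a ∷ g) h x = begin
    eval (a ·ₚ h +ₚ (0ℤ ∷ g *ₚ h)) x
      ≈⟨ eval-+ (a ·ₚ h) (0ℤ ∷ g *ₚ h) x ⟩
    eval (a ·ₚ h) x + (fromℤ 0ℤ + x * eval (g *ₚ h) x)
      ≈⟨ R.+-cong (eval-· a h x) (R.+-congˡ (R.*-congˡ (eval-* g h x))) ⟩
    fromℤ a * eval h x + (fromℤ 0ℤ + x * (eval g x * eval h x))
      ≈⟨ solve 4 (λ a x g h → a :* h :+ (con 0ℤ :+ x :* (g :* h)) := (a :+ x :* g) :* h)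
           R.refl _ x _ _ ⟩
    (fromℤ a + x * eval g x) * eval h x
      ∎

  eval-constant : ∀ a x → eval (a ∷ []) x ≈ fromℤ a
  eval-constant a x = R.trans (R.+-congˡ (R.zeroʳ x)) (R.+-identityʳ _)

  eval-syntheticQuotient : ∀ g r x →
    eval g x ≈ fromℤ (evalℤ g r) + (x - fromℤ r) * eval (syntheticQuotient r g) x
  eval-syntheticQuotient []      r x = R.sym
    (R.trans (R.+-cong fromℤ-0 (R.zeroʳ _)) (R.+-identityˡ 0#))
  eval-syntheticQuotient (a ∷ g) r x = begin
    fromℤ a + x * eval g x
      ≈⟨ R.+-congˡ (R.*-congˡ (eval-syntheticQuotient g r x)) ⟩
    fromℤ a + x * (v + (x - fromℤ r) * q)
      ≈⟨ solve 5 (λ a x v r q → a :+ x :* (v :+ (x :- r) :* q) :=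
           (a :+ r :* v) :+ (x :- r) :* (v :+ x :* q)) R.refl _ x v _ q ⟩
    (fromℤ a + fromℤ r * v) + (x - fromℤ r) * (v + x * q)
      ≈⟨ R.+-congʳ (R.trans (fromℤ-+ a _) (R.+-congˡ (fromℤ-* r _))) ⟨
    fromℤ (a ℤ.+ r ℤ.* evalℤ g r) + (x - fromℤ r) * (v + x * q)
      ∎
    where
    v = fromℤ (evalℤ g r)
    q = eval (syntheticQuotient r g) x

  Integer : Pred Carrier ℓ₁
  Integer x = ∃ λ a → fromℤ a ≈ x

  integer-subring : Subring Integer
  integer-subring = record
    { additive = record
      { ≈-closed = λ { x≈y (a , a≈) → a , R.trans a≈ x≈y }
      ; 0-closed = 0ℤ , fromℤ-0
      ; +-closed = λ { (a , a≈) (b , b≈) → a ℤ.+ b , R.trans (fromℤ-+ a b) (R.+-cong a≈ b≈) }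
      ; -‿closed = λ { (a , a≈) → ℤ.- a , R.trans (fromℤ-neg a) (R.-‿cong a≈) }
      }
    ; 1-closed = 1ℤ , fromℤ-1
    ; *-closed = λ { (a , a≈) (b , b≈) → a ℤ.* b , R.trans (fromℤ-* a b) (R.*-cong a≈ b≈) }
    }

  ℤ[_]-subring : ∀ y → Subring ℤ[ y ]
  ℤ[ y ]-subring = record
    { additive = record
      { ≈-closed = λ { x≈y (g , g≈) → g , R.trans g≈ x≈y }
      ; 0-closed = [] , R.refl
      ; +-closed = λ { (g , g≈) (h , h≈) → g +ₚ h , R.trans (eval-+ g h y) (R.+-cong g≈ h≈) }
      ; -‿closed = λ { (g , g≈) → -ₚ g , R.trans (eval-neg g y) (R.-‿cong g≈) }
      }
    ; 1-closed = 1ℤ ∷ [] , R.trans (eval-constant 1ℤ y) fromℤ-1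
    ; *-closed = λ { (g , g≈) (h , h≈) → g *ₚ h , R.trans (eval-* g h y) (R.*-cong g≈ h≈) }
    }

  private module Int = Subring integer-subring

  Low : Carrier → ℕ → Pred Carrier (c ⊔ ℓ₁)
  Low = LowDegree Integer

  Low-additive : ∀ x d → Additive (Low x d)
  Low-additive = low-additive integer-subring

  integer⊆ℤ[_] : ∀ y → Integer ⊆ ℤ[ y ]
  integer⊆ℤ[ y ] (a , a≈) = a ∷ [] , R.trans (eval-constant a y) a≈

  Low-cons : ∀ {x d} a {v} → Low x d v → Low x (suc d) (fromℤ a + x * v)
  Low-cons {x} {d} a v∈ = +-closed
    (≈-closed (R.*-identityʳ _) (span-generator Int.additive (s≤s z≤n) (a , R.refl)))
    (≈-closed (R.*-congʳ (R.*-identityʳ x)) (low-^ integer-subring x 1 d v∈))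
    where open Additive (Low-additive x (suc d))

  eval-monic : ∀ d g x → MonicOfDegree d g → ∃ λ l → Low x d l × eval g x ≈ x ^ᴷ d + l
  eval-monic zero    (a ∷ g) x (a≡1 , g<) = 0# , nil R.refl ,
    R.+-cong (R.trans (R.reflexive (cong fromℤ a≡1)) fromℤ-1)
             (R.trans (R.*-congˡ (eval-zero g x λ i _ → g< (suc i) (s≤s z≤n))) (R.zeroʳ x))
  eval-monic (suc d) (a ∷ g) x (g≡1 , g<)
    with eval-monic d g x (g≡1 , λ i lt → g< (suc i) (s≤s lt))
  ... | l , l∈ , g≈ = fromℤ a + x * l , Low-cons a l∈ ,
    R.trans (R.+-congˡ (R.*-congˡ g≈))
      (solve 4 (λ a x xd l → a :+ x :* (xd :+ l) := x :* xd :+ (a :+ x :* l)) R.refl _ x _ l)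

  monic-root⇒low : ∀ d g x → MonicOfDegree d g → eval g x ≈ 0# → Low x d (x ^ᴷ d)
  monic-root⇒low d g x monic g≈0 with eval-monic d g x monic
  ... | l , l∈ , g≈ = ≈-closed
    (begin
      - l                 ≈⟨ R.+-identityˡ _ ⟨
      0# - l              ≈⟨ R.+-congʳ (R.trans (R.sym g≈0) g≈) ⟩
      (x ^ᴷ d + l) - l    ≈⟨ solve 2 (λ y l → (y :+ l) :- l := y) R.refl _ l ⟩
      x ^ᴷ d              ∎)
    (-‿closed l∈)
    where open Additive (Low-additive x d)

  -- Together with `integral⇒𝒪` this passes between monic polynomials and spans, so that integrality
  -- arguments never touch coefficient lists.
  𝒪⇒integral : 𝒪 ⊆ IntegralOver Integer
  𝒪⇒integral {x} (g , (d , monic) , g≈0) = d , monic-root⇒low d g x monic g≈0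

  eval-monomial : ∀ a d x → eval (monomial a d) x ≈ fromℤ a * x ^ᴷ d
  eval-monomial a zero    x = R.trans (eval-constant a x) (R.sym (R.*-identityʳ _))
  eval-monomial a (suc d) x = begin
    fromℤ 0ℤ + x * eval (monomial a d) x  ≈⟨ R.+-congˡ (R.*-congˡ (eval-monomial a d x)) ⟩
    fromℤ 0ℤ + x * (fromℤ a * x ^ᴷ d)     ≈⟨ solve 3 (λ x a y → con 0ℤ :+ x :* (a :* y) := a :* (x :* y))
                                               R.refl x _ _ ⟩
    fromℤ a * (x * x ^ᴷ d)                ∎

  low⇒polynomial : ∀ {x d v} → Low x d v → ∃ λ g → DegreeBelow d g × eval g x ≈ v
  low⇒polynomial (nil v≈0) = [] , (λ _ _ → ≡.refl) , R.sym v≈0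
  low⇒polynomial {x} {suc d} (cons (a , a≈) w∈ v≈) with low⇒polynomial w∈
  ... | g , g< , g≈ = monomial a d +ₚ g ,
    (λ i lt → ≡.trans (coeff-+ (monomial a d) g i)
                (cong₂ ℤ._+_ (monomial< a d i lt) (g< i (ℕ.<⇒≤ lt)))) ,
    R.trans (eval-+ (monomial a d) g x)
      (R.trans (R.+-cong (R.trans (eval-monomial a d x) (R.*-congʳ a≈)) g≈) (R.sym v≈))

  integral⇒𝒪 : IntegralOver Integer ⊆ 𝒪
  integral⇒𝒪 {x} (d , xᵈ∈) with low⇒polynomial xᵈ∈
  ... | g , g< , g≈ = monomial 1ℤ d +ₚ -ₚ g , (d , leading , above) ,
    (begin
      eval (monomial 1ℤ d +ₚ -ₚ g) x
        ≈⟨ eval-+ (monomial 1ℤ d) (-ₚ g) x ⟩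
      eval (monomial 1ℤ d) x + eval (-ₚ g) x
        ≈⟨ R.+-cong (eval-monomial 1ℤ d x) (R.trans (eval-neg g x) (R.-‿cong g≈)) ⟩
      fromℤ 1ℤ * x ^ᴷ d - x ^ᴷ d
        ≈⟨ R.+-congʳ (R.trans (R.*-congʳ fromℤ-1) (R.*-identityˡ _)) ⟩
      x ^ᴷ d - x ^ᴷ d
        ≈⟨ R.-‿inverseʳ _ ⟩
      0#
        ∎)
    where
    coeffs : ∀ i → coeff (monomial 1ℤ d +ₚ -ₚ g) i ≡ coeff (monomial 1ℤ d) i ℤ.- coeff g i
    coeffs i = ≡.trans (coeff-+ (monomial 1ℤ d) (-ₚ g) i)
      (cong (λ z → coeff (monomial 1ℤ d) i ℤ.+ z) (coeff-neg g i))
    leading = ≡.trans (coeffs d) (cong₂ ℤ._-_ (coeff-monomial 1ℤ d) (g< d ℕ.≤-refl))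
    above : DegreeBelow (suc d) (monomial 1ℤ d +ₚ -ₚ g)
    above i lt = ≡.trans (coeffs i) (cong₂ ℤ._-_ (monomial< 1ℤ d i lt) (g< i (ℕ.<⇒≤ lt)))

  -- The monic relation brings the degree back below e after each multiplication by y in Horner's
  -- scheme.
  ℤ[]⊆low : ∀ {y e} → Low y e (y ^ᴷ e) → ℤ[ y ] ⊆ Low y e
  ℤ[]⊆low {y} {e} yᵉ∈ (g , g≈) = ≈-closed g≈ (eval∈ g)
    where
    open Additive (Low-additive y e)
    -- For e = 0 there is no generator to use, but the relation itself is about y⁰ = 1.
    1∈ : ∀ {e} → Low y e (y ^ᴷ e) → Low y e 1#
    1∈ {zero}  1∈0 = 1∈0
    1∈ {suc e} _   = Additive.≈-closed (Low-additive y (suc e)) (R.*-identityˡ _)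
      (span-generator Int.additive (s≤s z≤n) Int.1-closed)
    eval∈ : ∀ g → Low y e (eval g y)
    eval∈ []      = 0-closed
    eval∈ (a ∷ g) = +-closed
      (≈-closed (R.*-identityʳ _)
        (span-scale Int.additive (Int.*-closed (a , R.refl)) (1∈ yᵉ∈)))
      (low-closed-under-generator integer-subring yᵉ∈ (eval∈ g))

  𝒪-trans : ∀ {x y} → 𝒪 y → IntegralOver ℤ[ y ] x → 𝒪 x
  𝒪-trans {x} {y} y∈ (d , xᵈ∈) =
    let e , yᵉ∈ = 𝒪⇒integral y∈ in
    integral⇒𝒪 (integral-trans integer-subring yᵉ∈
      (d , span-mono (Low-additive y e) (ℤ[]⊆low yᵉ∈) ℕ.≤-refl xᵈ∈))

  -- A form of additivity of 𝒪 that suffices for the index: x is integral over ℤ, hence over ℤ[y]; a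
  -- shift by b in ℤ[y] preserves this, and transitivity leads back to ℤ.
  𝒪-translate : ∀ {x y b} → 𝒪 x → 𝒪 y → ℤ[ y ] b → 𝒪 (x + b)
  𝒪-translate {x} {y} x∈ y∈ b∈ =
    let d , xᵈ∈ = 𝒪⇒integral x∈ in
    𝒪-trans y∈ (translate-integral ℤ[ y ]-subring b∈
      (d , span-mono (Subring.additive ℤ[ y ]-subring) integer⊆ℤ[ y ] ℕ.≤-refl xᵈ∈))

  generator∈ℤ[_] : ∀ y → ℤ[ y ] y
  generator∈ℤ[ y ] = 0ℤ ∷ 1ℤ ∷ [] , (begin
    fromℤ 0ℤ + y * (fromℤ 1ℤ + y * 0#)  ≈⟨ R.+-cong fromℤ-0 (R.*-congˡ (eval-constant 1ℤ y)) ⟩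
    0# + y * fromℤ 1ℤ                   ≈⟨ R.trans (R.+-identityˡ _) (R.*-congˡ fromℤ-1) ⟩
    y * 1#                              ≈⟨ R.*-identityʳ y ⟩
    y                                   ∎)

  fromℤ-cancel : ∀ k {x y} → fromℤ (+ suc k) * x ≈ fromℤ (+ suc k) * y → x ≈ y
  fromℤ-cancel k {x} {y} eq = R.trans (R.sym (unscale x)) (R.trans (R.*-congˡ eq) (unscale y))
    where
    q = ι (1ℤ / suc k)
    unscale : ∀ z → q * (fromℤ (+ suc k) * z) ≈ z
    unscale z = begin
      q * (fromℤ (+ suc k) * z)    ≈⟨ solve 3 (λ q s z → q :* (s :* z) := (s :* q) :* z) R.refl q _ z ⟩
      fromℤ (+ suc k) * q * z      ≈⟨ R.*-congʳ (fromℤ-inverse k) ⟩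
      1# * z                       ≈⟨ R.*-identityˡ z ⟩
      z                            ∎

  -- The minimal polynomial of θ

  module MinimalPolynomial
    (f : ℤ[X]) {n : ℕ} (f-monic : MonicOfDegree n f) (f-irreducible : Irreducible f)
    (θ : Carrier) (fθ≈0 : eval f θ ≈ 0#) where

    -- One factor would be a unit. If q is, it is constant and q s has no coefficient at n, where f
    -- has 1; if s is, its vanishing at θ forces 1 ≈ 0.
    irreducible⇒¬factor : ∀ {k} → k ≤ n → ∀ q s → DegreeBelow k s → eval s θ ≈ 0# → ¬ f ≈ₚ q *ₚ s
    irreducible⇒¬factor {k} k≤n q s s< sθ≈0 f≈qs with Irreducible.split-∣1 f-irreducible f≈qs
    ... | inj₁ (y Divisibility., yq≈1) = contradiction
      (≡.trans (≡.sym (proj₁ f-monic))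
        (≡.trans (f≈qs n) (constant-*ₚ q s (unit⇒constant y q yq≈1) s< n k≤n))) λ ()
    ... | inj₂ (y Divisibility., ys≈1) = 1≉0 (begin
      1#                       ≈⟨ fromℤ-1 ⟨
      fromℤ 1ℤ                 ≈⟨ eval-constant 1ℤ θ ⟨
      eval (1ℤ ∷ []) θ         ≈⟨ eval-≈ₚ (y *ₚ s) (1ℤ ∷ []) θ ys≈1 ⟨
      eval (y *ₚ s) θ          ≈⟨ eval-* y s θ ⟩
      eval y θ * eval s θ      ≈⟨ R.*-congˡ sθ≈0 ⟩
      eval y θ * 0#            ≈⟨ R.zeroʳ _ ⟩
      0#                       ∎)

    -- By Gauss's lemma the primes of the scalar on the left cancel one at a time.
    irreducible⇒¬scaledFactor : ∀ {k} → k ≤ n → ∀ ps → All Prime ps →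
      ∀ q s → DegreeBelow k s → eval s θ ≈ 0# → ¬ (+ product ps) ·ₚ f ≈ₚ q *ₚ s
    irreducible⇒¬scaledFactor k≤n [] [] q s s< sθ≈0 f≈qs =
      irreducible⇒¬factor k≤n q s s< sθ≈0 λ i →
        ≡.trans (≡.trans (≡.sym (ℤ.*-identityˡ _)) (≡.sym (coeff-· 1ℤ f i))) (f≈qs i)
    irreducible⇒¬scaledFactor k≤n (zero ∷ ps) (0-prime ∷ _) = contradiction 0-prime Primality.¬prime[0]
    irreducible⇒¬scaledFactor {k} k≤n (p@(suc p-1) ∷ ps) (p-prime ∷ primes) q s s< sθ≈0 pf≈qs =
      [ cancelˡ , cancelʳ ]′
        (gauss p-prime q s λ i → Signed.divides (+ product ps ℤ.* coeff f i)
          (≡.trans (≡.sym (factor i)) (ℤ.*-comm (+ p) _)))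
      where
      factor : ∀ i → + p ℤ.* (+ product ps ℤ.* coeff f i) ≡ coeff (q *ₚ s) i
      factor i = ≡.trans (≡.sym (coeff-pos-*-· p (product ps) f i)) (pf≈qs i)

      cancelled : ∀ h → q *ₚ s ≈ₚ + p ·ₚ h → (+ product ps) ·ₚ f ≈ₚ h
      cancelled h qs≈ph i = ≡.trans (coeff-· (+ product ps) f i)
        (ℤ.*-cancelˡ-≡ (+ p) _ _ (≡.trans (factor i) (≡.trans (qs≈ph i) (coeff-· (+ p) h i))))

      cancelˡ : ¬ + p ∣ₚ q
      cancelˡ p∣q with ∣ₚ⇒·ₚ (+ p) q p∣q
      ... | q′ , ≡.refl = irreducible⇒¬scaledFactor k≤n ps primes q′ s s< sθ≈0
        (cancelled (q′ *ₚ s) (·ₚ-*ₚ-assoc (+ p) q′ s))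

      cancelʳ : ¬ + p ∣ₚ s
      cancelʳ p∣s with ∣ₚ⇒·ₚ (+ p) s p∣s
      ... | s′ , ≡.refl = irreducible⇒¬scaledFactor k≤n ps primes q s′
        (λ i le → ℤ.*-cancelˡ-≡ (+ p) _ _
          (≡.trans (≡.sym (coeff-· (+ p) s′ i)) (≡.trans (s< i le) (≡.sym (ℤ.*-zeroʳ (+ p))))))
        (fromℤ-cancel p-1 (R.trans (R.sym (eval-· (+ p) s′ θ)) (R.trans sθ≈0 (R.sym (R.zeroʳ _)))))
        (cancelled (q *ₚ s′) (*ₚ-·ₚ-comm q (+ p) s′))

    -- If s had exact degree k, dividing f by s would give b f = q s + t with t(θ) = 0 and t of
    -- degree below k. By induction t = 0, so s would divide a nonzero multiple of f, which
    -- irreducibility excludes.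
    vanishing-below-degree : ∀ k → k ≤ n → ∀ s → DegreeBelow k s → eval s θ ≈ 0# → DegreeBelow 0 s
    vanishing-below-degree zero    _   s s< _ = s<
    vanishing-below-degree (suc k) k<n s s< sθ≈0 with coeff s k ℤ.≟ 0ℤ
    ... | yes sₖ≡0 = vanishing-below-degree k (ℕ.<⇒≤ k<n) s s<k sθ≈0
      where
      s<k : DegreeBelow k s
      s<k i k≤i with ℕ.m≤n⇒m<n∨m≡n k≤i
      ... | inj₁ k<i    = s< i k<i
      ... | inj₂ ≡.refl = sₖ≡0
    ... | no sₖ≢0 with pseudoDivision k s sₖ≢0 s< f
    ...   | b , b≢0 , q , t , t< , bf≈qs+t = contradiction bf≈qs (¬bf≈qs b b≢0 q)
      where
      tθ≈0 : eval t θ ≈ 0#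
      tθ≈0 = begin
        eval t θ                            ≈⟨ R.+-identityˡ _ ⟨
        0# + eval t θ                       ≈⟨ R.+-congʳ (R.trans (R.*-congˡ sθ≈0) (R.zeroʳ _)) ⟨
        eval q θ * eval s θ + eval t θ      ≈⟨ R.+-congʳ (eval-* q s θ) ⟨
        eval (q *ₚ s) θ + eval t θ          ≈⟨ eval-+ (q *ₚ s) t θ ⟨
        eval (q *ₚ s +ₚ t) θ                ≈⟨ eval-≈ₚ (b ·ₚ f) (q *ₚ s +ₚ t) θ bf≈qs+t ⟨
        eval (b ·ₚ f) θ                     ≈⟨ eval-· b f θ ⟩
        fromℤ b * eval f θ                  ≈⟨ R.trans (R.*-congˡ fθ≈0) (R.zeroʳ _) ⟩
        0#                                  ∎

      bf≈qs : b ·ₚ f ≈ₚ q *ₚ s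
      bf≈qs i = ≡.trans (bf≈qs+t i) (≡.trans (coeff-+ (q *ₚ s) t i)
        (≡.trans (cong (λ z → coeff (q *ₚ s) i ℤ.+ z)
                   (vanishing-below-degree k (ℕ.<⇒≤ k<n) t t< tθ≈0 i z≤n))
                 (ℤ.+-identityʳ _)))

      ¬natural : ∀ m → .{{ℕ.NonZero m}} → ∀ q → ¬ + m ·ₚ f ≈ₚ q *ₚ s
      ¬natural m q mf≈qs = irreducible⇒¬scaledFactor k<n factors factorsPrime q s s< sθ≈0
        (≡.subst (λ z → + z ·ₚ f ≈ₚ q *ₚ s) isFactorisation mf≈qs)
        where open PrimeFactorisation (factorise m)

      ¬bf≈qs : ∀ b → b ≢ 0ℤ → ∀ q → ¬ b ·ₚ f ≈ₚ q *ₚ s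
      ¬bf≈qs (+ zero)      b≢0 q _     = b≢0 ≡.refl
      ¬bf≈qs (+ m@(suc _)) b≢0 q mf≈qs = ¬natural m q mf≈qs
      -- The sign moves into q, since the factorisation into primes is for natural scalars.
      ¬bf≈qs -[1+ m ]      b≢0 q bf≈qs = ¬natural (suc m) (ℤ.-1ℤ ·ₚ q) λ i →
        ≡.trans (coeff-· (+ suc m) f i)
          (≡.trans
            (≡.trans (cong (ℤ._* coeff f i) (≡.sym (ℤ.-1*i≡-i -[1+ m ])))
                     (ℤ.*-assoc ℤ.-1ℤ -[1+ m ] (coeff f i)))
            (≡.trans (cong (ℤ.-1ℤ ℤ.*_) (≡.trans (≡.sym (coeff-· -[1+ m ] f i)) (bf≈qs i)))
              (≡.sym (≡.trans (·ₚ-*ₚ-assoc ℤ.-1ℤ q s i) (coeff-· ℤ.-1ℤ (q *ₚ s) i)))))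

  -- The index

  ×ᴷ-fromℤ : ∀ n x → n ×ᴷ x ≈ fromℤ (+ n) * x
  ×ᴷ-fromℤ zero    x = R.sym (R.trans (R.*-congʳ fromℤ-0) (R.zeroˡ x))
  ×ᴷ-fromℤ (suc n) x = begin
    x + n ×ᴷ x                        ≈⟨ R.+-congˡ (×ᴷ-fromℤ n x) ⟩
    x + fromℤ (+ n) * x               ≈⟨ solve 2 (λ k x → x :+ k :* x := (con 1ℤ :+ k) :* x) R.refl _ x ⟩
    (fromℤ 1ℤ + fromℤ (+ n)) * x      ≈⟨ R.*-congʳ (fromℤ-+ 1ℤ (+ n)) ⟨
    fromℤ (+ suc n) * x               ∎

  module _ {a} {A : Pred Carrier a} (A-additive : Additive A) where
    open Additive A-additive

    ×ᴷ-closed : ∀ n {x} → A x → A (n ×ᴷ x)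
    ×ᴷ-closed zero    Ax = 0-closed
    ×ᴷ-closed (suc n) Ax = +-closed Ax (×ᴷ-closed n Ax)

    sum-closed : ∀ {n} (t : Fin n → Carrier) → (∀ i → A (t i)) → A (sum t)
    sum-closed {zero}  t At = 0-closed
    sum-closed {suc n} t At = +-closed (At Fin.zero)
      (sum-closed (λ i → t (Fin.suc i)) (λ i → At (Fin.suc i)))

    private
      combination : ∀ {x} u m v n → 1 ℕ.+ v ℕ.* n ≡ u ℕ.* m → A (m ×ᴷ x) → A (n ×ᴷ x) → A x
      combination {x} u m v n 1+vn≡um Amx Anx = ≈-closed
        (begin
          u ×ᴷ (m ×ᴷ x) - v ×ᴷ (n ×ᴷ x)          ≈⟨ R.+-cong (×-assocˡ x u m) (R.-‿cong (×-assocˡ x v n)) ⟩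
          (u ℕ.* m) ×ᴷ x - (v ℕ.* n) ×ᴷ x        ≈⟨ R.+-congʳ (R.reflexive (cong (_×ᴷ x) 1+vn≡um)) ⟨
          (x + (v ℕ.* n) ×ᴷ x) - (v ℕ.* n) ×ᴷ x  ≈⟨ solve 2 (λ x y → (x :+ y) :- y := x) R.refl x _ ⟩
          x                                      ∎)
        (minus-closed (×ᴷ-closed u Amx) (×ᴷ-closed v Anx))

    coprime-closed : ∀ {m n x} → Coprime m n → A (m ×ᴷ x) → A (n ×ᴷ x) → A x
    coprime-closed {m} {n} coprime Amx Anx with coprime-Bézout coprime
    ... | Bézout.+- u v 1+vn≡um = combination u m v n 1+vn≡um Amx Anx
    ... | Bézout.-+ u v 1+um≡vn = combination v n u m 1+um≡vn Anx Amx

  -- Translation by α permutes the classes, so comparing the sums of the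
  -- representatives before and after leaves m α ∈ ℤ[θ].
  index-annihilates : ∀ {θ m α} → HasIndex θ m → 𝒪 α → ℤ[ θ ] (m ×ᴷ α)
  index-annihilates {θ} {m} {α} index α∈ = ≈-closed -Σz≈mα (-‿closed (sum-closed additive z z∈))
    where
    open Subring ℤ[ θ ]-subring
    open Bijection index using (to; injective; strictlySurjective) renaming (cong to to-cong)
    module A = Subring ℤ[ α ]-subring

    e : Fin m → Carrier
    e i = proj₁ (proj₁ (strictlySurjective i))

    -- The shift b ranges over ℤ[α], so that one construction yields both the translation by α and
    -- its inverse, the translation by -α.
    translate : ∀ {b} → ℤ[ α ] b → Fin m → Fin m
    translate {b} b∈ i =
      let (x , x∈) , _ = strictlySurjective i in to (x + b , 𝒪-translate x∈ α∈ b∈)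

    e-translate : ∀ {b} (b∈ : ℤ[ α ] b) i → ℤ[ θ ] (e (translate b∈ i) - (e i + b))
    e-translate b∈ i = injective (proj₂ (strictlySurjective (translate b∈ i)))

    translate-inverse : ∀ {b b′} (b∈ : ℤ[ α ] b) (b′∈ : ℤ[ α ] b′) → b + b′ ≈ 0# →
      ∀ i → translate b′∈ (translate b∈ i) ≡ i
    translate-inverse {b} {b′} b∈ b′∈ b+b′≈0 i = ≡.trans
      (to-cong (≈-closed
        (begin
          j - (e i + b)                  ≈⟨ solve 3 (λ j i b → j :- (i :+ b) := (j :- i) :- b) R.refl j (e i) b ⟩
          j - e i - b                    ≈⟨ solve 4 (λ j i b b′ →
                                               (j :- i) :- b := ((j :+ b′) :- i) :- (b :+ b′))
                                              R.refl j (e i) b b′ ⟩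
          j + b′ - e i - (b + b′)        ≈⟨ R.+-congˡ (R.-‿cong b+b′≈0) ⟩
          j + b′ - e i - 0#              ≈⟨ R.+-congˡ ε⁻¹≈ε ⟩
          j + b′ - e i + 0#              ≈⟨ R.+-identityʳ _ ⟩
          j + b′ - e i                   ∎)
        (e-translate b∈ i)))
      (proj₂ (strictlySurjective i))
      where j = e (translate b∈ i)

    α∈ℤ[α] = generator∈ℤ[ α ]
    -α∈ℤ[α] = A.-‿closed α∈ℤ[α]

    π : Permutation m m
    π = permutation (translate α∈ℤ[α]) (translate -α∈ℤ[α])
      (translate-inverse -α∈ℤ[α] α∈ℤ[α] (R.-‿inverseˡ α))
      (translate-inverse α∈ℤ[α] -α∈ℤ[α] (R.-‿inverseʳ α))

    z : Fin m → Carrier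
    z i = e (translate α∈ℤ[α] i) - (e i + α)

    z∈ : ∀ i → ℤ[ θ ] (z i)
    z∈ = e-translate α∈ℤ[α]

    Σe≈Σe+mα+Σz : sum e ≈ sum e + (m ×ᴷ α + sum z)
    Σe≈Σe+mα+Σz = begin
      sum e
        ≈⟨ sum-permute e π ⟩
      sum (λ i → e (translate α∈ℤ[α] i))
        ≈⟨ sum-cong-≋ (λ i → solve 3 (λ x y a → x := y :+ (a :+ (x :- (y :+ a)))) R.refl _ (e i) α) ⟩
      sum (λ i → e i + (α + z i))
        ≈⟨ ∑-distrib-+ e (λ i → α + z i) ⟩
      sum e + sum (λ i → α + z i)
        ≈⟨ R.+-congˡ (R.trans (∑-distrib-+ (λ _ → α) z) (R.+-congʳ (sum-replicate m))) ⟩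
      sum e + (m ×ᴷ α + sum z)
        ∎

    -Σz≈mα : - sum z ≈ m ×ᴷ α
    -Σz≈mα = begin
      - sum z
        ≈⟨ solve 2 (λ s z → :- z := s :+ (:- s :- z)) R.refl (sum e) (sum z) ⟩
      sum e + (- sum e - sum z)
        ≈⟨ R.+-congʳ Σe≈Σe+mα+Σz ⟩
      sum e + (m ×ᴷ α + sum z) + (- sum e - sum z)
        ≈⟨ solve 3 (λ s a z → s :+ (a :+ z) :+ (:- s :- z) := a) R.refl (sum e) _ (sum z) ⟩
      m ×ᴷ α
        ∎

  -- The element α: integral, outside ℤ[θ], with p α in ℤ[θ]

  module _ {f : ℤ[X]} {n : ℕ} (f-monic : MonicOfDegree (suc n) f) (f-irreducible : Irreducible f)
    {θ : Carrier} (fθ≈0 : eval f θ ≈ 0#) {p-1 : ℕ} (p-prime : Prime (suc p-1)) (r : ℤ) where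

    private
      p = suc p-1
      P = fromℤ (+ p)
      module ℤ[θ] = Subring ℤ[ θ ]-subring
      g = syntheticQuotient r f
      h = syntheticQuotient r g
      β = θ - fromℤ r
      G = eval g θ
      H = eval h θ
      p⁻¹ = ι (1ℤ / p)
      pp⁻¹≈1 = fromℤ-inverse p-1

    α : Carrier
    α = p⁻¹ * G

    pα≈G : P * α ≈ G
    pα≈G = R.trans (R.sym (R.*-assoc _ _ _)) (R.trans (R.*-congʳ pp⁻¹≈1) (R.*-identityˡ G))

    pα∈ℤ[θ] : ℤ[ θ ] (p ×ᴷ α)
    pα∈ℤ[θ] = g , R.sym (R.trans (×ᴷ-fromℤ p α) pα≈G)

    -- Since f is monic, u can be reduced below deg f = n + 1. Then p u - g must vanish identically;
    -- as g is monic of degree n, its coefficient at n gives p uₙ = 1, so p divides 1.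
    α∉ℤ[θ] : ¬ ℤ[ θ ] α
    α∉ℤ[θ] α∈ with low⇒polynomial (ℤ[]⊆low (monic-root⇒low (suc n) f θ f-monic fθ≈0) α∈)
    ... | u , u< , uθ≈α = Primality.¬prime[1] (≡.subst Prime p≡1 p-prime)
      where
      open MinimalPolynomial f f-monic f-irreducible θ fθ≈0
      s = + p ·ₚ u +ₚ -ₚ g

      g-monic : MonicOfDegree n g
      g-monic = syntheticQuotient-monic n r f f-monic

      coeff-s : ∀ i → coeff s i ≡ + p ℤ.* coeff u i ℤ.- coeff g i
      coeff-s i = ≡.trans (coeff-+ (+ p ·ₚ u) (-ₚ g) i)
        (cong₂ ℤ._+_ (coeff-· (+ p) u i) (coeff-neg g i))

      s< : DegreeBelow (suc n) s
      s< i lt = ≡.trans (coeff-s i) (≡.trans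
        (cong₂ (λ y z → + p ℤ.* y ℤ.- z) (u< i lt) (proj₂ g-monic i lt))
        (≡.trans (ℤ.+-identityʳ _) (ℤ.*-zeroʳ (+ p))))

      sθ≈0 : eval s θ ≈ 0#
      sθ≈0 = begin
        eval s θ                              ≈⟨ eval-+ (+ p ·ₚ u) (-ₚ g) θ ⟩
        eval (+ p ·ₚ u) θ + eval (-ₚ g) θ     ≈⟨ R.+-cong (eval-· (+ p) u θ) (eval-neg g θ) ⟩
        P * eval u θ - G                      ≈⟨ R.+-congʳ (R.trans (R.*-congˡ uθ≈α) pα≈G) ⟩
        G - G                                 ≈⟨ R.-‿inverseʳ G ⟩
        0#                                    ∎

      pu≡1 : + p ℤ.* coeff u n ≡ 1ℤ
      pu≡1 = ℤ.i-j≡0⇒i≡j _ _ (≡.trans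
        (≡.sym (≡.trans (coeff-s n) (cong (λ z → + p ℤ.* coeff u n ℤ.- z) (proj₁ g-monic))))
        (vanishing-below-degree (suc n) ℕ.≤-refl s s< sθ≈0 n z≤n))

      p≡1 : p ≡ 1
      p≡1 = ∣1⇒≡1 (Signed.∣⇒∣ᵤ (Signed.divides {+ p} {1ℤ} (coeff u n)
        (≡.trans (≡.sym pu≡1) (ℤ.*-comm (+ p) _))))

    α∈𝒪 : (+ p) ^ 2 ∣ℤ evalℤ f r → + p ∣ℤ evalℤ (derivative f) r → 𝒪 α
    α∈𝒪 p²∣f[r] p∣f′[r]
      with Signed.∣ᵤ⇒∣ {(+ p) ^ 2} {evalℤ f r} p²∣f[r]
         | Signed.∣ᵤ⇒∣ {+ p} {evalℤ (derivative f) r} p∣f′[r]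
    ... | Signed.divides d f[r]≡dp² | Signed.divides b f′[r]≡bp =
      𝒪-trans (f , (suc n , f-monic) , fθ≈0)
        -- Coefficients from the top power down: b at α, then -d h(θ) at 1.
        (2 , cons (b ∷ [] , eval-constant b θ)
               (cons (ℤ[θ].-‿closed (ℤ[θ].*-closed (d ∷ [] , eval-constant d θ) (h , R.refl)))
                 (nil R.refl) R.refl)
               quadratic)
      where
      B = fromℤ b
      D = fromℤ d

      βG≈ : β * G ≈ - (D * (P * P))
      βG≈ = begin
        β * G
          ≈⟨ solve 2 (λ x y → y := :- x :+ (x :+ y)) R.refl (D * (P * P)) (β * G) ⟩
        - (D * (P * P)) + (D * (P * P) + β * G)
          ≈⟨ R.+-congˡ (R.+-congʳ dp²) ⟨
        - (D * (P * P)) + (fromℤ (evalℤ f r) + β * G)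
          ≈⟨ R.+-congˡ (R.trans (R.sym (eval-syntheticQuotient f r θ)) fθ≈0) ⟩
        - (D * (P * P)) + 0#
          ≈⟨ R.+-identityʳ _ ⟩
        - (D * (P * P))
          ∎
        where
        dp² : fromℤ (evalℤ f r) ≈ D * (P * P)
        dp² = R.trans
          (R.reflexive (cong fromℤ
            (≡.trans f[r]≡dp² (cong (λ z → d ℤ.* (+ p ℤ.* z)) (ℤ.*-identityʳ (+ p))))))
          (R.trans (fromℤ-* d _) (R.*-congˡ (fromℤ-* (+ p) (+ p))))

      G≈ : G ≈ B * P + β * H
      G≈ = R.trans (eval-syntheticQuotient g r θ) (R.+-congʳ (R.trans
        (R.reflexive (cong fromℤ (≡.trans (evalℤ-syntheticQuotient r f) f′[r]≡bp)))
        (fromℤ-* b (+ p))))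

      -- Only one of the two factors G is expanded: the other then meets β, and β G = -d p² absorbs
      -- both factors p⁻¹.
      quadratic : α ^ᴷ 2 ≈ B * α ^ᴷ 1 + (- (D * H) * α ^ᴷ 0 + 0#)
      quadratic = begin
        α * (α * 1#)
          ≈⟨ R.*-congˡ (R.*-identityʳ α) ⟩
        p⁻¹ * G * (p⁻¹ * G)
          ≈⟨ R.*-congˡ (R.*-congˡ G≈) ⟩
        p⁻¹ * G * (p⁻¹ * (B * P + β * H))
          ≈⟨ solve 6 (λ q g b p β h →
               q :* g :* (q :* (b :* p :+ β :* h)) :=
               (p :* q) :* (b :* (q :* g)) :+ q :* q :* (β :* g :* h)) R.refl p⁻¹ G B P β H ⟩
        P * p⁻¹ * (B * α) + p⁻¹ * p⁻¹ * (β * G * H)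
          ≈⟨ R.+-congˡ (R.*-congˡ (R.*-congʳ βG≈)) ⟩
        P * p⁻¹ * (B * α) + p⁻¹ * p⁻¹ * (- (D * (P * P)) * H)
          ≈⟨ solve 5 (λ q p x d h →
               p :* q :* x :+ q :* q :* (:- (d :* (p :* p)) :* h) :=
               p :* q :* x :+ p :* q :* (p :* q :* :- (d :* h))) R.refl p⁻¹ P (B * α) D H ⟩
        P * p⁻¹ * (B * α) + P * p⁻¹ * (P * p⁻¹ * - (D * H))
          ≈⟨ R.+-cong (unit _) (R.trans (unit _) (unit _)) ⟩
        B * α + - (D * H)
          ≈⟨ R.+-cong (R.*-congˡ (R.*-identityʳ α)) (R.trans (R.+-identityʳ _) (R.*-identityʳ _)) ⟨
        B * (α * 1#) + (- (D * H) * 1# + 0#)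
          ∎
        where
        unit : ∀ x → P * p⁻¹ * x ≈ x
        unit x = R.trans (R.*-congʳ pp⁻¹≈1) (R.*-identityˡ x)

theorem3p2 : ∀ {c ℓ₁ ℓ₂} (f : ℤ[X]) (n : ℕ) → 2 ≤ n → MonicOfDegree n f → Irreducible f →
    (K : ExtensionOfℚ c ℓ₁ ℓ₂) (let open Extension K) (θ : Carrier) →
    eval f θ ≈ 0# → GeneratedBy θ →
    (p : ℕ) → Prime p → (r : ℤ) →
    ((+ p) ^ 2) ∣ℤ evalℤ f r → (+ p) ∣ℤ evalℤ (derivative f) r →
    (∀ (m : ℕ) → HasIndex θ m → p ∣ m) × ¬ (ℤ[ θ ] ≐ 𝒪)
-- The split on p exposes it as a successor, the form in which 1/p is defined.
theorem3p2 f (suc n) 2≤n f-monic f-irreducible K θ fθ≈0 _ zero p-prime =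
  contradiction p-prime Primality.¬prime[0]
theorem3p2 f (suc n) 2≤n f-monic f-irreducible K θ fθ≈0 _ p@(suc _) p-prime r p²∣f[r] p∣f′[r] =
  -- Divisibility in ℕ is decidable, so p ∤ m may be assumed; then m and p are coprime, and m α and
  -- p α in ℤ[θ] yield α by Bézout.
  (λ m index → decidable-stable (p ∣? m) λ p∤m →
    α∉ (coprime-closed (Subring.additive ℤ[ θ ]-subring) (prime∤⇒coprime p-prime p∤m)
      (index-annihilates index α∈)
      (pα∈ℤ[θ] f-monic f-irreducible fθ≈0 p-prime r))) ,
  -- The element α separates the two rings, whether or not an index m is given.
  λ (_ , 𝒪⊆ℤ[θ]) → α∉ (𝒪⊆ℤ[θ] α∈)
  where
  open Extension K
  open ExtensionProperties K
  α∉ = α∉ℤ[θ] f-monic f-irreducible fθ≈0 p-prime r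
  α∈ = α∈𝒪 f-monic f-irreducible fθ≈0 p-prime r p²∣f[r] p∣f′[r]
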